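{- Let $\lambda$ be a nonzero real number. For any integer $p\ge2$, \[ \sum_{k=1}^{\infty}\frac{(-1)^{k-1}\lambda^{k-1}(1)_{k,1/\lambda}}{(k-1)!\,k^{p}(k+1)}=\sum_{k=1}^{p-1}(-1)^{k-1}\zeta_{\lambda}(p-k+1)+\frac{(-1)^{p-1}}{\lambda+1}. \]
   Context: For real $x$ and $\mu\neq 0$, set $(x)_{0,\mu}=1$ and $(x)_{n,\mu}=x(x-\mu)\cdots(x-(n-1)\mu)$ for $n\ge1$; thus $(1)_{k,1/\lambda}=1\cdot(1-\tfrac1\lambda)\cdots(1-\tfrac{k-1}{\lambda})$. The degenerate zeta function is $\zeta_{\lambda}(s)=\sum_{n=1}^{\infty}\frac{(-1)^{n-1}\lambda^{n-1}(1)_{n,1/\lambda}}{(n-1)!\,n^{s}}$ for $\mathrm{Re}(s)>1$.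
   Formalization: For λ ≤ -1 the series ζ_λ(2) diverges (e.g. λ = -2), and 1/(λ+1) is undefined at λ = -1; the formal theorem assumes λ ≠ -1 and that ζ_λ(2),…,ζ_λ(p) converge, and proves this convergence for every nonzero λ > -1. -}

module Defs where

open import Algebra.Bundles.Raw using (RawSemiring)
import Algebra.Definitions.RawSemiring as RawSemiringDefs
open import Data.Integer.Base as ℤ using (+_)
open import Data.Nat.Base as ℕ using (ℕ; zero; suc; _∸_; NonZero; _!)
import Data.Nat.Properties as ℕ
open import Data.Product.Base using (∃-syntax; _×_; _,_)
open import Data.Rational as ℚ using (ℚ; 0ℚ; 1ℚ)
import Data.Rational.Properties as ℚ
open import Data.Rational.Solver using (module +-*-Solver)
open import Data.Sum.Base using (_⊎_; inj₁; inj₂)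
open import Level using (0ℓ)
open import Relation.Binary.PropositionalEquality
open import Relation.Nullary.Decidable.Core using (yes; no)
open import Relation.Nullary.Negation.Core using (contradiction)

-- Real numbers as Cauchy sequences of rationals.  No Bishop-style fixed rate
-- is imposed, so the field operations act termwise.

IsCauchy : (ℕ → ℚ) → Set
IsCauchy x = ∀ ε → 0ℚ ℚ.< ε →
  ∃[ N ] ∀ m n → N ℕ.≤ m → N ℕ.≤ n → ℚ.∣ x m ℚ.- x n ∣ ℚ.< ε

record ℝ : Set where
  constructor mkℝ
  field
    approx : ℕ → ℚ
    cauchy : IsCauchy approx

open ℝ public

open +-*-Solver

half : ∀ {ε} → 0ℚ ℚ.< ε → 0ℚ ℚ.< ℚ.½ ℚ.* ε
half 0<ε = ℚ.*-monoʳ-<-pos ℚ.½ 0<ε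

half+half : ∀ ε → ℚ.½ ℚ.* ε ℚ.+ ℚ.½ ℚ.* ε ≡ ε
half+half ε = trans (sym (ℚ.*-distribʳ-+ ε ℚ.½ ℚ.½)) (ℚ.*-identityˡ ε)

p-p≡0 : ∀ p → p ℚ.- p ≡ 0ℚ
p-p≡0 = ℚ.+-inverseʳ

*-mono : ∀ {a b c d} → 0ℚ ℚ.≤ b → 0ℚ ℚ.≤ c → a ℚ.≤ b → c ℚ.≤ d →
         a ℚ.* c ℚ.≤ b ℚ.* d
*-mono {b = b} {c} 0≤b 0≤c a≤b c≤d = ℚ.≤-trans
  (ℚ.*-monoʳ-≤-nonNeg c {{ℚ.nonNegative 0≤c}} a≤b)
  (ℚ.*-monoˡ-≤-nonNeg b {{ℚ.nonNegative 0≤b}} c≤d)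

∣-∣-triangle⁻ : ∀ a b → ℚ.∣ a ∣ ℚ.≤ ℚ.∣ a ℚ.- b ∣ ℚ.+ ℚ.∣ b ∣
∣-∣-triangle⁻ a b = subst (λ t → ℚ.∣ t ∣ ℚ.≤ ℚ.∣ a ℚ.- b ∣ ℚ.+ ℚ.∣ b ∣)
  (solve 2 (λ a b → (a :- b) :+ b := a) refl a b)
  (ℚ.∣p+q∣≤∣p∣+∣q∣ (a ℚ.- b) b)

∣-∣-comm : ∀ a b → ℚ.∣ a ℚ.- b ∣ ≡ ℚ.∣ b ℚ.- a ∣
∣-∣-comm a b = trans (sym (ℚ.∣-p∣≡∣p∣ (a ℚ.- b)))
  (cong ℚ.∣_∣ (solve 2 (λ a b → :- (a :- b) := b :- a) refl a b))

∣∣-∣∣-≤ : ∀ a b → ℚ.∣ ℚ.∣ a ∣ ℚ.- ℚ.∣ b ∣ ∣ ℚ.≤ ℚ.∣ a ℚ.- b ∣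
∣∣-∣∣-≤ a b with ℚ.∣p∣≡p∨∣p∣≡-p (ℚ.∣ a ∣ ℚ.- ℚ.∣ b ∣)
... | inj₁ eq = subst (ℚ._≤ ℚ.∣ a ℚ.- b ∣) (sym eq) (move a b)
  where
  move : ∀ a b → ℚ.∣ a ∣ ℚ.- ℚ.∣ b ∣ ℚ.≤ ℚ.∣ a ℚ.- b ∣
  move a b = subst (ℚ.∣ a ∣ ℚ.- ℚ.∣ b ∣ ℚ.≤_)
    (solve 2 (λ x y → (x :+ y) :- y := x) refl ℚ.∣ a ℚ.- b ∣ ℚ.∣ b ∣)
    (ℚ.+-monoˡ-≤ (ℚ.- ℚ.∣ b ∣) (∣-∣-triangle⁻ a b))
... | inj₂ eq = subst (ℚ._≤ ℚ.∣ a ℚ.- b ∣) (sym eq)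
  (subst₂ ℚ._≤_
    (solve 2 (λ x y → y :- x := :- (x :- y)) refl ℚ.∣ a ∣ ℚ.∣ b ∣)
    refl
    (subst (ℚ.∣ b ∣ ℚ.- ℚ.∣ a ∣ ℚ.≤_)
      (solve 2 (λ x y → (x :+ y) :- y := x) refl ℚ.∣ a ℚ.- b ∣ ℚ.∣ a ∣)
      (ℚ.+-monoˡ-≤ (ℚ.- ℚ.∣ a ∣)
        (subst (λ t → ℚ.∣ b ∣ ℚ.≤ t ℚ.+ ℚ.∣ a ∣) (∣-∣-comm b a) (∣-∣-triangle⁻ b a)))))

fromℚ : ℚ → ℝ
fromℚ q = mkℝ (λ _ → q) λ ε 0<ε → 0 , λ _ _ _ _ →
  subst (λ t → ℚ.∣ t ∣ ℚ.< ε) (sym (p-p≡0 q)) 0<ε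

fromℕ : ℕ → ℝ
fromℕ n = fromℚ (+ n ℚ./ 1)

0ℝ 1ℝ : ℝ
0ℝ = fromℚ 0ℚ
1ℝ = fromℚ 1ℚ

infix  8 -_ _⁻¹⟨_⟩
infixl 7 _*_ _/ℕ_
infixl 6 _+_ _-_
infix  4 _≈_ _<_ _#_ _⟶_

-_ : ℝ → ℝ
- x = mkℝ (λ n → ℚ.- approx x n) λ ε 0<ε →
  let N , h = cauchy x ε 0<ε in
  N , λ m n N≤m N≤n → subst (ℚ._< ε)
    (trans (sym (ℚ.∣-p∣≡∣p∣ (approx x m ℚ.- approx x n)))
      (cong ℚ.∣_∣ (solve 2 (λ a b → :- (a :- b) := :- a :- :- b) refl (approx x m) (approx x n))))
    (h m n N≤m N≤n)

_+_ : ℝ → ℝ → ℝ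
x + y = mkℝ (λ n → approx x n ℚ.+ approx y n) λ ε 0<ε →
  let M , h = cauchy x (ℚ.½ ℚ.* ε) (half 0<ε)
      N , k = cauchy y (ℚ.½ ℚ.* ε) (half 0<ε)
  in M ℕ.⊔ N , λ m n ≤m ≤n → bound ε m n
       (h m n (ℕ.m⊔n≤o⇒m≤o M N ≤m) (ℕ.m⊔n≤o⇒m≤o M N ≤n))
       (k m n (ℕ.m⊔n≤o⇒n≤o M N ≤m) (ℕ.m⊔n≤o⇒n≤o M N ≤n))
  where
  bound : ∀ ε m n →
    ℚ.∣ approx x m ℚ.- approx x n ∣ ℚ.< ℚ.½ ℚ.* ε →
    ℚ.∣ approx y m ℚ.- approx y n ∣ ℚ.< ℚ.½ ℚ.* ε →
    ℚ.∣ approx x m ℚ.+ approx y m ℚ.- (approx x n ℚ.+ approx y n) ∣ ℚ.< ε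
  bound ε m n p q = begin-strict
    ℚ.∣ a ℚ.+ c ℚ.- (b ℚ.+ d) ∣
      ≡⟨ cong ℚ.∣_∣ (solve 4 (λ a b c d → a :+ c :- (b :+ d) := (a :- b) :+ (c :- d)) refl a b c d) ⟩
    ℚ.∣ (a ℚ.- b) ℚ.+ (c ℚ.- d) ∣       ≤⟨ ℚ.∣p+q∣≤∣p∣+∣q∣ (a ℚ.- b) (c ℚ.- d) ⟩
    ℚ.∣ a ℚ.- b ∣ ℚ.+ ℚ.∣ c ℚ.- d ∣     <⟨ ℚ.+-mono-< p q ⟩
    ℚ.½ ℚ.* ε ℚ.+ ℚ.½ ℚ.* ε            ≡⟨ half+half ε ⟩
    ε                                   ∎
    where
    open ℚ.≤-Reasoning
    a = approx x m
    b = approx x n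
    c = approx y m
    d = approx y n

_-_ : ℝ → ℝ → ℝ
x - y = x + - y

∣_∣ : ℝ → ℝ
∣ x ∣ = mkℝ (λ n → ℚ.∣ approx x n ∣) λ ε 0<ε →
  let N , h = cauchy x ε 0<ε in
  N , λ m n N≤m N≤n → ℚ.≤-<-trans (∣∣-∣∣-≤ (approx x m) (approx x n)) (h m n N≤m N≤n)

eventually-bounded : ∀ x → ∃[ B ] 0ℚ ℚ.< B × ∃[ N ] ∀ n → N ℕ.≤ n → ℚ.∣ approx x n ∣ ℚ.≤ B
eventually-bounded x =
  let N , h = cauchy x 1ℚ (ℚ.positive⁻¹ 1ℚ) in
  1ℚ ℚ.+ ℚ.∣ approx x N ∣ ,
  ℚ.+-mono-<-≤ (ℚ.positive⁻¹ 1ℚ) (ℚ.0≤∣p∣ (approx x N)) ,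
  N , λ n N≤n → ℚ.≤-trans (∣-∣-triangle⁻ (approx x n) (approx x N))
    (ℚ.+-monoˡ-≤ ℚ.∣ approx x N ∣ (ℚ.<⇒≤ (h n N N≤n ℕ.≤-refl)))

_*_ : ℝ → ℝ → ℝ
x * y = mkℝ (λ n → approx x n ℚ.* approx y n) λ ε 0<ε →
  let B , 0<B , K , p = eventually-bounded x
      C , 0<C , L , q = eventually-bounded y
      0<B+C = ℚ.+-mono-< 0<B 0<C
      instance
        B+C⁺ = ℚ.positive 0<B+C
        B+C≢0 = ℚ.pos⇒nonZero (B ℚ.+ C)
        1/B+C⁺ = ℚ.1/pos⇒pos (B ℚ.+ C)
      δ = ε ℚ.* ℚ.1/ (B ℚ.+ C)
      0<δ = subst (ℚ._< δ) (ℚ.*-zeroˡ (ℚ.1/ (B ℚ.+ C))) (ℚ.*-monoˡ-<-pos (ℚ.1/ (B ℚ.+ C)) 0<ε)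
      M , h = cauchy x δ 0<δ
      N , k = cauchy y δ 0<δ
      δ*[B+C]≡ε = trans (ℚ.*-assoc ε (ℚ.1/ (B ℚ.+ C)) (B ℚ.+ C))
        (trans (cong (ε ℚ.*_) (ℚ.*-inverseˡ (B ℚ.+ C))) (ℚ.*-identityʳ ε))
  in (K ℕ.⊔ L) ℕ.⊔ (M ℕ.⊔ N) , λ m n ≤m ≤n →
     let ≤m₁ = ℕ.m⊔n≤o⇒m≤o (K ℕ.⊔ L) (M ℕ.⊔ N) ≤m
         ≤n₁ = ℕ.m⊔n≤o⇒m≤o (K ℕ.⊔ L) (M ℕ.⊔ N) ≤n
         ≤m₂ = ℕ.m⊔n≤o⇒n≤o (K ℕ.⊔ L) (M ℕ.⊔ N) ≤m
         ≤n₂ = ℕ.m⊔n≤o⇒n≤o (K ℕ.⊔ L) (M ℕ.⊔ N) ≤n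
     in subst (ℚ.∣ approx x m ℚ.* approx y m ℚ.- approx x n ℚ.* approx y n ∣ ℚ.<_) δ*[B+C]≡ε
       (bound B C δ 0<B 0<C m n
         (p m (ℕ.m⊔n≤o⇒m≤o K L ≤m₁))
         (q n (ℕ.m⊔n≤o⇒n≤o K L ≤n₁))
         (h m n (ℕ.m⊔n≤o⇒m≤o M N ≤m₂) (ℕ.m⊔n≤o⇒m≤o M N ≤n₂))
         (k m n (ℕ.m⊔n≤o⇒n≤o M N ≤m₂) (ℕ.m⊔n≤o⇒n≤o M N ≤n₂)))
  where
  bound : ∀ B C δ → 0ℚ ℚ.< B → 0ℚ ℚ.< C → ∀ m n →
    ℚ.∣ approx x m ∣ ℚ.≤ B → ℚ.∣ approx y n ∣ ℚ.≤ C →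
    ℚ.∣ approx x m ℚ.- approx x n ∣ ℚ.< δ →
    ℚ.∣ approx y m ℚ.- approx y n ∣ ℚ.< δ →
    ℚ.∣ approx x m ℚ.* approx y m ℚ.- approx x n ℚ.* approx y n ∣ ℚ.< δ ℚ.* (B ℚ.+ C)
  bound B C δ 0<B 0<C m n ∣a∣≤B ∣d∣≤C p q = begin-strict
    ℚ.∣ a ℚ.* c ℚ.- b ℚ.* d ∣
      ≡⟨ cong ℚ.∣_∣ (solve 4 (λ a b c d →
           a :* c :- b :* d := a :* (c :- d) :+ (a :- b) :* d) refl a b c d) ⟩
    ℚ.∣ a ℚ.* (c ℚ.- d) ℚ.+ (a ℚ.- b) ℚ.* d ∣
      ≤⟨ ℚ.∣p+q∣≤∣p∣+∣q∣ (a ℚ.* (c ℚ.- d)) ((a ℚ.- b) ℚ.* d) ⟩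
    ℚ.∣ a ℚ.* (c ℚ.- d) ∣ ℚ.+ ℚ.∣ (a ℚ.- b) ℚ.* d ∣
      ≡⟨ cong₂ ℚ._+_ (ℚ.∣p*q∣≡∣p∣*∣q∣ a (c ℚ.- d)) (ℚ.∣p*q∣≡∣p∣*∣q∣ (a ℚ.- b) d) ⟩
    ℚ.∣ a ∣ ℚ.* ℚ.∣ c ℚ.- d ∣ ℚ.+ ℚ.∣ a ℚ.- b ∣ ℚ.* ℚ.∣ d ∣
      ≤⟨ ℚ.+-mono-≤
           (ℚ.*-monoʳ-≤-nonNeg ℚ.∣ c ℚ.- d ∣ {{ℚ.∣-∣-nonNeg (c ℚ.- d)}} ∣a∣≤B)
           (ℚ.*-monoˡ-≤-nonNeg ℚ.∣ a ℚ.- b ∣ {{ℚ.∣-∣-nonNeg (a ℚ.- b)}} ∣d∣≤C) ⟩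
    B ℚ.* ℚ.∣ c ℚ.- d ∣ ℚ.+ ℚ.∣ a ℚ.- b ∣ ℚ.* C
      <⟨ ℚ.+-mono-<
           (ℚ.*-monoʳ-<-pos B {{ℚ.positive 0<B}} q)
           (ℚ.*-monoˡ-<-pos C {{ℚ.positive 0<C}} p) ⟩
    B ℚ.* δ ℚ.+ δ ℚ.* C
      ≡⟨ solve 3 (λ B C δ → B :* δ :+ δ :* C := δ :* (B :+ C)) refl B C δ ⟩
    δ ℚ.* (B ℚ.+ C) ∎
    where
    open ℚ.≤-Reasoning
    a = approx x m
    b = approx x n
    c = approx y m
    d = approx y n

_≈_ : ℝ → ℝ → Set
x ≈ y = ∀ ε → 0ℚ ℚ.< ε → ∃[ N ] ∀ n → N ℕ.≤ n → ℚ.∣ approx x n ℚ.- approx y n ∣ ℚ.< ε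

_<_ : ℝ → ℝ → Set
x < y = ∃[ δ ] 0ℚ ℚ.< δ × ∃[ N ] ∀ n → N ℕ.≤ n → approx x n ℚ.+ δ ℚ.< approx y n

-- Apartness, the positive form of x ≠ y.
_#_ : ℝ → ℝ → Set
x # y = x < y ⊎ y < x

recip : ℚ → ℚ
recip q with q ℚ.≟ 0ℚ
... | yes _   = 0ℚ
... | no  q≢0 = (ℚ.1/ q) {{ℚ.≢-nonZero q≢0}}

recip-inverse : ∀ {q} → 0ℚ ℚ.< ℚ.∣ q ∣ → recip q ℚ.* q ≡ 1ℚ
recip-inverse {q} 0<∣q∣ with q ℚ.≟ 0ℚ
... | yes refl = contradiction 0<∣q∣ (ℚ.<-irrefl refl)
... | no  q≢0  = ℚ.*-inverseˡ q {{ℚ.≢-nonZero q≢0}}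

bounded-away : ∀ {x} → x # 0ℝ →
  ∃[ δ ] 0ℚ ℚ.< δ × ∃[ N ] ∀ n → N ℕ.≤ n → δ ℚ.≤ ℚ.∣ approx x n ∣
bounded-away {x} (inj₁ (δ , 0<δ , N , h)) = δ , 0<δ , N , λ n N≤n →
  let x+δ<0 = h n N≤n
      δ≤-x = subst₂ ℚ._≤_
        (solve 2 (λ x δ → (x :+ δ) :- x := δ) refl (approx x n) δ)
        (ℚ.+-identityˡ (ℚ.- approx x n))
        (ℚ.+-monoˡ-≤ (ℚ.- approx x n) (ℚ.<⇒≤ x+δ<0))
  in subst (δ ℚ.≤_)
       (trans (sym (ℚ.0≤p⇒∣p∣≡p (ℚ.≤-trans (ℚ.<⇒≤ 0<δ) δ≤-x))) (ℚ.∣-p∣≡∣p∣ (approx x n)))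
       δ≤-x
bounded-away {x} (inj₂ (δ , 0<δ , N , h)) = δ , 0<δ , N , λ n N≤n →
  let δ≤x = subst (ℚ._≤ approx x n) (ℚ.+-identityˡ δ) (ℚ.<⇒≤ (h n N≤n))
  in subst (δ ℚ.≤_) (sym (ℚ.0≤p⇒∣p∣≡p (ℚ.≤-trans (ℚ.<⇒≤ 0<δ) δ≤x))) δ≤x

recip-bound : ∀ {a b δ ε} → 0ℚ ℚ.< δ → δ ℚ.≤ ℚ.∣ a ∣ → δ ℚ.≤ ℚ.∣ b ∣ →
  ℚ.∣ a ℚ.- b ∣ ℚ.< ε ℚ.* (δ ℚ.* δ) → ℚ.∣ recip a ℚ.- recip b ∣ ℚ.< ε
recip-bound {a} {b} {δ} {ε} 0<δ δ≤a δ≤b p =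
  ℚ.*-cancelʳ-<-nonNeg (δ ℚ.* δ) {{ℚ.pos⇒nonNeg (δ ℚ.* δ)}} (begin-strict
    ℚ.∣ r ℚ.- s ∣ ℚ.* (δ ℚ.* δ)
      ≤⟨ ℚ.*-monoˡ-≤-nonNeg ℚ.∣ r ℚ.- s ∣ {{ℚ.∣-∣-nonNeg (r ℚ.- s)}}
           (*-mono (ℚ.0≤∣p∣ a) (ℚ.<⇒≤ 0<δ) δ≤a δ≤b) ⟩
    ℚ.∣ r ℚ.- s ∣ ℚ.* (ℚ.∣ a ∣ ℚ.* ℚ.∣ b ∣)
      ≡⟨ cong (ℚ.∣ r ℚ.- s ∣ ℚ.*_) (sym (ℚ.∣p*q∣≡∣p∣*∣q∣ a b)) ⟩
    ℚ.∣ r ℚ.- s ∣ ℚ.* ℚ.∣ a ℚ.* b ∣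
      ≡⟨ sym (ℚ.∣p*q∣≡∣p∣*∣q∣ (r ℚ.- s) (a ℚ.* b)) ⟩
    ℚ.∣ (r ℚ.- s) ℚ.* (a ℚ.* b) ∣
      ≡⟨ cong ℚ.∣_∣ (solve 4 (λ r s a b →
           (r :- s) :* (a :* b) := (r :* a) :* b :- (s :* b) :* a) refl r s a b) ⟩
    ℚ.∣ (r ℚ.* a) ℚ.* b ℚ.- (s ℚ.* b) ℚ.* a ∣
      ≡⟨ cong₂ (λ t u → ℚ.∣ t ℚ.* b ℚ.- u ℚ.* a ∣)
           (recip-inverse (ℚ.<-≤-trans 0<δ δ≤a)) (recip-inverse (ℚ.<-≤-trans 0<δ δ≤b)) ⟩
    ℚ.∣ 1ℚ ℚ.* b ℚ.- 1ℚ ℚ.* a ∣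
      ≡⟨ cong₂ (λ t u → ℚ.∣ t ℚ.- u ∣) (ℚ.*-identityˡ b) (ℚ.*-identityˡ a) ⟩
    ℚ.∣ b ℚ.- a ∣
      ≡⟨ ∣-∣-comm b a ⟩
    ℚ.∣ a ℚ.- b ∣
      <⟨ p ⟩
    ε ℚ.* (δ ℚ.* δ) ∎)
  where
  open ℚ.≤-Reasoning
  r = recip a
  s = recip b
  instance
    δ⁺ = ℚ.positive 0<δ
    δδ⁺ = ℚ.pos*pos⇒pos δ δ

_⁻¹⟨_⟩ : ∀ x → x # 0ℝ → ℝ
x ⁻¹⟨ x#0 ⟩ = mkℝ (λ n → recip (approx x n)) λ ε 0<ε →
  let δ , 0<δ , M , p = bounded-away {x} x#0
      instance
        δ⁺ = ℚ.positive 0<δ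
        δδ⁺ = ℚ.pos*pos⇒pos δ δ
      η = ε ℚ.* (δ ℚ.* δ)
      0<η = subst (ℚ._< η) (ℚ.*-zeroˡ (δ ℚ.* δ)) (ℚ.*-monoˡ-<-pos (δ ℚ.* δ) 0<ε)
      N , h = cauchy x η 0<η
  in M ℕ.⊔ N , λ m n ≤m ≤n → recip-bound 0<δ
       (p m (ℕ.m⊔n≤o⇒m≤o M N ≤m)) (p n (ℕ.m⊔n≤o⇒m≤o M N ≤n))
       (h m n (ℕ.m⊔n≤o⇒n≤o M N ≤m) (ℕ.m⊔n≤o⇒n≤o M N ≤n))

_/ℕ_ : ℝ → (d : ℕ) .{{_ : NonZero d}} → ℝ
x /ℕ d = x * fromℚ (+ 1 ℚ./ d)

+-*-rawSemiring : RawSemiring 0ℓ 0ℓ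
+-*-rawSemiring = record
  { Carrier = ℝ ; _≈_ = _≈_ ; _+_ = _+_ ; _*_ = _*_ ; 0# = 0ℝ ; 1# = 1ℝ }

open RawSemiringDefs +-*-rawSemiring public using (_^_)

-- Sequences indexed from 1.
Seq : Set
Seq = (n : ℕ) → .{{_ : NonZero n}} → ℝ

-- ∑ n f is f 1 + ⋯ + f n.
∑ : ℕ → Seq → ℝ
∑ zero    f = 0ℝ
∑ (suc n) f = ∑ n f + f (suc n)

_⟶_ : (ℕ → ℝ) → ℝ → Set
x ⟶ L = ∀ ε → 0ℚ ℚ.< ε → ∃[ N ] ∀ n → N ℕ.≤ n → ∣ x n - L ∣ < fromℚ ε

HasSum : Seq → ℝ → Set
HasSum f L = (λ n → ∑ n f) ⟶ L

Summable : Seq → Set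
Summable f = ∃[ L ] HasSum f L

-- (x)_{n,μ} = x (x - μ) ⋯ (x - (n - 1) μ)
degenerateFalling : ℝ → ℕ → ℝ → ℝ
degenerateFalling x zero    μ = 1ℝ
degenerateFalling x (suc n) μ = degenerateFalling x n μ * (x - fromℕ n * μ)

module _ (l : ℝ) (l#0 : l # 0ℝ) where

  -- (-1)^{n-1} l^{n-1} (1)_{n,1/l}
  numerator : Seq
  numerator n = (- 1ℝ) ^ (n ∸ 1) * l ^ (n ∸ 1) * degenerateFalling 1ℝ n (l ⁻¹⟨ l#0 ⟩)

  -- The summand of the degenerate zeta function at a natural number s.
  ζ-term : ℕ → Seq
  ζ-term s n = numerator n /ℕ ((n ∸ 1) ! ℕ.* n ℕ.^ s)
    where instance
      _ = (n ∸ 1) ℕ.!≢0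
      _ = ℕ.m^n≢0 n s
      _ = ℕ.m*n≢0 ((n ∸ 1) !) (n ℕ.^ s)

  shifted-term : ℕ → Seq
  shifted-term p k = numerator k /ℕ ((k ∸ 1) ! ℕ.* k ℕ.^ p ℕ.* (k ℕ.+ 1))
    where instance
      _ = (k ∸ 1) ℕ.!≢0
      _ = ℕ.m^n≢0 k p
      _ = ℕ.m*n≢0 ((k ∸ 1) !) (k ℕ.^ p)
      _ = ℕ.>-nonZero (ℕ.m≤n+m 1 k)
      _ = ℕ.m*n≢0 ((k ∸ 1) ! ℕ.* k ℕ.^ p) (k ℕ.+ 1)

{-# OPTIONS --safe #-}
-- Write aₙ for the coefficients of ζ_λ, so that aₙ₊₁ = aₙ (n - λ) / n, and put
-- t = λ + 1 and cₙ = aₙ / n.  Then cₙ₊₁ = cₙ (1 - t / (n + 1)), whence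
-- t ∑ₙ≤N aₙ / (n (n + 1)) = 1 - c_{N+1}.  For t > 0 the cₙ eventually decrease
-- in absolute value and, the harmonic series being divergent, tend to 0; the
-- same telescoping bounds the tails of ∑ aₙ / nˢ for s ≥ 2.  For t < 0 all
-- cₙ ≥ 1 and ∑ aₙ / n² diverges.  The formula then follows by induction on p
-- from 1 / (nᵖ⁺¹ (n + 1)) = 1 / nᵖ⁺¹ - 1 / (nᵖ (n + 1)).
--
-- A real number here is a sequence of rationals and the operations act termwise,
-- so every identity holds exactly at all late enough indices j, and the estimates
-- only have to be uniform in the rational value of λ at j.

module Submission where

module RationalEstimates where
  open import Defs using (*-mono; half)
  open import Data.Integer.Base as ℤ using (-[1+_])
  import Data.Integer.Properties as ℤ
  open import Data.Nat.Base as ℕ using (ℕ; zero; suc; z≤n; s≤s; NonZero)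
  import Data.Nat.Properties as ℕ
  open import Data.Product.Base using (∃-syntax; _×_; _,_)
  open import Data.Rational.Base hiding (NonZero)
  open import Data.Rational.Properties
  open import Data.Rational.Solver using (module +-*-Solver)
  open import Data.Rational.Unnormalised.Base as ℚᵘ using (mkℚᵘ; *≡*; *≤*)
  import Data.Rational.Unnormalised.Properties as ℚᵘ
  open import Data.Sum.Base using (inj₁; inj₂)
  open import Relation.Binary.PropositionalEquality

  open +-*-Solver

  -- Naturals and their reciprocals as rationals.

  nat : ℕ → ℚ
  nat n = ℤ.+ n / 1

  -- Opaque, so that conversion checking never unfolds gcds of factorials and powers.
  opaque
    inv : (n : ℕ) .{{_ : NonZero n}} → ℚ
    inv n = ℤ.+ 1 / n

    inv-def : ∀ n .{{_ : NonZero n}} → inv n ≡ ℤ.+ 1 / n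
    inv-def n = refl

  -- Checked on unnormalised fractions, where equality is cross-multiplication and no gcd
  -- intervenes; `nat-*-inv` and `inv-*` take the same route.
  nat-suc : ∀ n → nat (suc n) ≡ nat n + 1ℚ
  nat-suc n = toℚᵘ-injective (begin
    toℚᵘ (nat (suc n))           ≈⟨ toℚᵘ-fromℚᵘ (mkℚᵘ (ℤ.+ suc n) 0) ⟩
    mkℚᵘ (ℤ.+ suc n) 0             ≈⟨ *≡* (cong (ℤ._* ℤ.+ 1) (sym (trans (cong (ℤ._+ ℤ.+ 1) (ℤ.*-identityʳ (ℤ.+ n))) (cong ℤ.+_ (ℕ.+-comm n 1))))) ⟩
    mkℚᵘ (ℤ.+ n) 0 ℚᵘ.+ ℚᵘ.1ℚᵘ     ≈⟨ ℚᵘ.+-congˡ ℚᵘ.1ℚᵘ (ℚᵘ.≃-sym (toℚᵘ-fromℚᵘ (mkℚᵘ (ℤ.+ n) 0))) ⟩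
    toℚᵘ (nat n) ℚᵘ.+ toℚᵘ 1ℚ    ≈⟨ ℚᵘ.≃-sym (toℚᵘ-homo-+ (nat n) 1ℚ) ⟩
    toℚᵘ (nat n + 1ℚ)            ∎)
    where open ℚᵘ.≃-Reasoning

  opaque
    unfolding inv

    nat-*-inv : ∀ n .{{_ : NonZero n}} → nat n * inv n ≡ 1ℚ
    nat-*-inv (suc n) = toℚᵘ-injective (begin
      toℚᵘ (nat (suc n) * inv (suc n))           ≈⟨ toℚᵘ-homo-* (nat (suc n)) (inv (suc n)) ⟩
      toℚᵘ (nat (suc n)) ℚᵘ.* toℚᵘ (inv (suc n)) ≈⟨ ℚᵘ.*-cong (toℚᵘ-fromℚᵘ (mkℚᵘ (ℤ.+ suc n) 0)) (toℚᵘ-fromℚᵘ (mkℚᵘ (ℤ.+ 1) n)) ⟩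
      mkℚᵘ (ℤ.+ suc n) 0 ℚᵘ.* mkℚᵘ (ℤ.+ 1) n         ≈⟨ *≡* (cong ℤ.+_ (cong suc (trans (ℕ.*-identityʳ _) (trans (ℕ.*-identityʳ n) (sym (trans (ℕ.+-identityʳ _) (ℕ.+-identityʳ n))))))) ⟩
      toℚᵘ 1ℚ                                    ∎)
      where open ℚᵘ.≃-Reasoning

    inv-* : ∀ m n .{{_ : NonZero m}} .{{_ : NonZero n}} .{{_ : NonZero (m ℕ.* n)}} →
            inv (m ℕ.* n) ≡ inv m * inv n
    inv-* (suc m) (suc n) = toℚᵘ-injective (begin
      toℚᵘ (inv (suc m ℕ.* suc n))               ≈⟨ toℚᵘ-fromℚᵘ (mkℚᵘ (ℤ.+ 1) (n ℕ.+ m ℕ.* suc n)) ⟩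
      mkℚᵘ (ℤ.+ 1) m ℚᵘ.* mkℚᵘ (ℤ.+ 1) n             ≈⟨ ℚᵘ.≃-sym (ℚᵘ.*-cong (toℚᵘ-fromℚᵘ (mkℚᵘ (ℤ.+ 1) m)) (toℚᵘ-fromℚᵘ (mkℚᵘ (ℤ.+ 1) n))) ⟩
      toℚᵘ (inv (suc m)) ℚᵘ.* toℚᵘ (inv (suc n)) ≈⟨ ℚᵘ.≃-sym (toℚᵘ-homo-* (inv (suc m)) (inv (suc n))) ⟩
      toℚᵘ (inv (suc m) * inv (suc n))           ∎)
      where open ℚᵘ.≃-Reasoning

    inv-antimono : ∀ m n .{{_ : NonZero m}} .{{_ : NonZero n}} → m ℕ.≤ n → inv n ≤ inv m
    inv-antimono (suc m) (suc n) m≤n = toℚᵘ-cancel-≤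
      (ℚᵘ.≤-respʳ-≃ (ℚᵘ.≃-sym (toℚᵘ-fromℚᵘ (mkℚᵘ (ℤ.+ 1) m)))
        (ℚᵘ.≤-respˡ-≃ (ℚᵘ.≃-sym (toℚᵘ-fromℚᵘ (mkℚᵘ (ℤ.+ 1) n)))
          (*≤* (ℤ.*-monoˡ-≤-nonNeg (ℤ.+ 1) (ℤ.+≤+ m≤n)))))

    inv-pos : ∀ n .{{_ : NonZero n}} → Positive (inv n)
    inv-pos n = normalize-pos 1 n

  inv≤1 : ∀ n .{{_ : NonZero n}} → inv n ≤ 1ℚ
  inv≤1 (suc n) = subst (inv (suc n) ≤_) (inv-def 1) (inv-antimono 1 (suc n) (s≤s z≤n))

  0≤inv : ∀ n .{{_ : NonZero n}} → 0ℚ ≤ inv n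
  0≤inv n = <⇒≤ (positive⁻¹ (inv n) {{inv-pos n}})

  nat-mono : ∀ {m n} → m ℕ.≤ n → nat m ≤ nat n
  nat-mono {m} {n} m≤n = toℚᵘ-cancel-≤
    (ℚᵘ.≤-respʳ-≃ (ℚᵘ.≃-sym (toℚᵘ-fromℚᵘ (mkℚᵘ (ℤ.+ n) 0)))
      (ℚᵘ.≤-respˡ-≃ (ℚᵘ.≃-sym (toℚᵘ-fromℚᵘ (mkℚᵘ (ℤ.+ m) 0)))
        (*≤* (ℤ.*-monoʳ-≤-nonNeg (ℤ.+ 1) (ℤ.+≤+ m≤n)))))

  -- A nonnegative fraction is at most its numerator, its denominator being at least 1; a negative
  -- one is below 0.
  archimedean : ∀ q → ∃[ n ] q ≤ nat n
  archimedean q@(mkℚ (ℤ.+ n) d _) = n , toℚᵘ-cancel-≤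
    (ℚᵘ.≤-respʳ-≃ (ℚᵘ.≃-sym (toℚᵘ-fromℚᵘ (mkℚᵘ (ℤ.+ n) 0)))
      (*≤* (ℤ.*-monoˡ-≤-nonNeg (ℤ.+ n) (ℤ.+≤+ (s≤s z≤n)))))
  archimedean q@(mkℚ -[1+ n ] d _) = 0 , toℚᵘ-cancel-≤ (*≤* ℤ.-≤+)

  -- Finite sums of rationals.

  sum : (ℕ → ℚ) → ℕ → ℚ
  sum f zero    = 0ℚ
  sum f (suc n) = sum f n + f n

  sum-split : ∀ f d m → sum f (d ℕ.+ m) ≡ sum f m + sum (λ i → f (i ℕ.+ m)) d
  sum-split f zero    m = sym (+-identityʳ (sum f m))
  sum-split f (suc d) m = trans (cong (_+ f (d ℕ.+ m)) (sum-split f d m))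
    (+-assoc (sum f m) (sum (λ i → f (i ℕ.+ m)) d) (f (d ℕ.+ m)))

  -- Comparison is asked for up to index d only: `size-*-harmonic` bounds the earlier sizes below by
  -- the one at d.
  sum-mono : ∀ {f g} d → (∀ i → i ℕ.≤ d → f i ≤ g i) → sum f d ≤ sum g d
  sum-mono zero    f≤g = ≤-refl
  sum-mono (suc d) f≤g = +-mono-≤ (sum-mono d λ i i≤d → f≤g i (ℕ.m≤n⇒m≤1+n i≤d)) (f≤g d (ℕ.n≤1+n d))

  sum-scale : ∀ c f d → sum (λ i → c * f i) d ≡ c * sum f d
  sum-scale c f zero    = sym (*-zeroʳ c)
  sum-scale c f (suc d) = trans (cong (_+ c * f d) (sum-scale c f d)) (sym (*-distribˡ-+ c (sum f d) (f d)))

  0≤sum : ∀ {f} → (∀ i → 0ℚ ≤ f i) → ∀ d → 0ℚ ≤ sum f d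
  0≤sum 0≤f zero    = ≤-refl
  0≤sum 0≤f (suc d) = +-mono-≤ (0≤sum 0≤f d) (0≤f d)

  ∣sum∣≤sum∣∣ : ∀ f d → ∣ sum f d ∣ ≤ sum (λ i → ∣ f i ∣) d
  ∣sum∣≤sum∣∣ f zero    = ≤-refl
  ∣sum∣≤sum∣∣ f (suc d) = ≤-trans (∣p+q∣≤∣p∣+∣q∣ (sum f d) (f d)) (+-monoˡ-≤ ∣ f d ∣ (∣sum∣≤sum∣∣ f d))

  -- Divergence of the harmonic series.

  -- Starts at ½, the weights 1 / (n + 1) being those of the telescoping sum.
  harmonic : ℕ → ℚ
  harmonic = sum (λ i → inv (2 ℕ.+ i))

  -- The d terms from index m on have denominators at most d + m + 1, so each is at least 1 / (D +
  -- 1).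
  harmonic-block : ∀ m D d → d ℕ.+ m ℕ.≤ D → harmonic m + nat d * inv (suc D) ≤ harmonic (d ℕ.+ m)
  harmonic-block m D zero    _ = ≤-reflexive
    (trans (cong (_+_ (harmonic m)) (*-zeroˡ (inv (suc D)))) (+-identityʳ (harmonic m)))
  harmonic-block m D (suc d) d+m<D = begin
    harmonic m + nat (suc d) * inv (suc D)
      ≡⟨ cong (λ x → harmonic m + x * inv (suc D)) (nat-suc d) ⟩
    harmonic m + (nat d + 1ℚ) * inv (suc D)
      ≡⟨ solve 3 (λ h n i → h :+ (n :+ con 1ℚ) :* i := (h :+ n :* i) :+ i) refl (harmonic m) (nat d) (inv (suc D)) ⟩
    (harmonic m + nat d * inv (suc D)) + inv (suc D)
      ≤⟨ +-mono-≤ (harmonic-block m D d (ℕ.<⇒≤ d+m<D)) (inv-antimono (2 ℕ.+ (d ℕ.+ m)) (suc D) (s≤s d+m<D)) ⟩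
    harmonic (suc d ℕ.+ m) ∎
    where open ≤-Reasoning

  nat-*-inv-double : ∀ n .{{_ : NonZero n}} .{{_ : NonZero (2 ℕ.* n)}} → nat n * inv (2 ℕ.* n) ≡ ½
  nat-*-inv-double n = begin
    nat n * inv (2 ℕ.* n)   ≡⟨ cong (nat n *_) (trans (inv-* 2 n) (cong (_* inv n) (inv-def 2))) ⟩
    nat n * (½ * inv n)     ≡⟨ solve 3 (λ a b c → a :* (b :* c) := b :* (a :* c)) refl (nat n) ½ (inv n) ⟩
    ½ * (nat n * inv n)     ≡⟨ cong (½ *_) (nat-*-inv n) ⟩
    ½ * 1ℚ                  ≡⟨⟩
    ½                       ∎
    where open ≡-Reasoning

  -- Oresme's argument: m + 2 further terms, each at least 1 / (2 (m + 2)), contribute at least ½.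
  harmonic-double : ∀ m → harmonic m + ½ ≤ harmonic (2 ℕ.+ m ℕ.+ m)
  harmonic-double m = subst (λ x → harmonic m + x ≤ harmonic (2 ℕ.+ m ℕ.+ m))
    (nat-*-inv-double (2 ℕ.+ m))
    (harmonic-block m _ (2 ℕ.+ m)
      (ℕ.s≤s⁻¹ (ℕ.≤-trans (ℕ.≤-reflexive (sym (ℕ.+-suc (2 ℕ.+ m) m)))
        (ℕ.+-monoʳ-≤ (2 ℕ.+ m) (ℕ.≤-trans (ℕ.n≤1+n (suc m)) (ℕ.≤-reflexive (sym (ℕ.+-identityʳ (2 ℕ.+ m)))))))))

  harmonic-grows : ∀ k m → ∃[ d ] harmonic m + nat k * ½ ≤ harmonic (d ℕ.+ m)
  harmonic-grows zero    m = 0 , ≤-reflexive (+-identityʳ (harmonic m))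
  harmonic-grows (suc k) m =
    let d , h = harmonic-grows k m
    -- Doubling leads from d + m to 2 + (d + m) + (d + m), which lies this many terms past m.
    in 2 ℕ.+ (d ℕ.+ m) ℕ.+ d , (begin
      harmonic m + nat (suc k) * ½
        ≡⟨ cong (λ x → harmonic m + x * ½) (nat-suc k) ⟩
      harmonic m + (nat k + 1ℚ) * ½
        ≡⟨ solve 3 (λ h n i → h :+ (n :+ con 1ℚ) :* i := (h :+ n :* i) :+ i) refl (harmonic m) (nat k) ½ ⟩
      (harmonic m + nat k * ½) + ½
        ≤⟨ +-monoˡ-≤ ½ h ⟩
      harmonic (d ℕ.+ m) + ½
        ≤⟨ harmonic-double (d ℕ.+ m) ⟩
      harmonic (2 ℕ.+ (d ℕ.+ m) ℕ.+ (d ℕ.+ m))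
        ≡⟨ cong harmonic (sym (ℕ.+-assoc (2 ℕ.+ (d ℕ.+ m)) d m)) ⟩
      harmonic (2 ℕ.+ (d ℕ.+ m) ℕ.+ d ℕ.+ m) ∎)
    where open ≤-Reasoning

  harmonic-diverges : ∀ m B → ∃[ d ] B ≤ sum (λ i → inv (2 ℕ.+ (i ℕ.+ m))) d
  harmonic-diverges m B =
    -- Each doubling gains ½, so 2B of them are enough to reach B.
    let k , 2B≤k = archimedean (B + B)
        d , h = harmonic-grows k m
    in d , (begin
      B
        ≡⟨ solve 1 (λ b → b := (b :+ b) :* con ½) refl B ⟩
      (B + B) * ½
        ≤⟨ *-monoʳ-≤-nonNeg ½ 2B≤k ⟩
      nat k * ½
        ≡⟨ solve 2 (λ h x → x := (h :+ x) :- h) refl (harmonic m) (nat k * ½) ⟩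
      harmonic m + nat k * ½ - harmonic m
        ≤⟨ +-monoˡ-≤ (- harmonic m) h ⟩
      harmonic (d ℕ.+ m) - harmonic m
        ≡⟨ cong (_- harmonic m) (sum-split _ d m) ⟩
      harmonic m + sum (λ i → inv (2 ℕ.+ (i ℕ.+ m))) d - harmonic m
        ≡⟨ solve 2 (λ h x → (h :+ x) :- h := x) refl (harmonic m) (sum (λ i → inv (2 ℕ.+ (i ℕ.+ m))) d) ⟩
      sum (λ i → inv (2 ℕ.+ (i ℕ.+ m))) d ∎)
    where open ≤-Reasoning

  -- The form that `unbounded⇒¬⟶` asks for: the full partial sums reach B at some index no earlier
  -- than m.
  harmonic-unbounded : ∀ m B → ∃[ d ] B ≤ harmonic (d ℕ.+ m)
  harmonic-unbounded m B =
    let d , B≤H = harmonic-diverges m B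
    in d , (begin
      B                                                      ≤⟨ B≤H ⟩
      sum (λ i → inv (2 ℕ.+ (i ℕ.+ m))) d                    ≡⟨ sym (+-identityˡ _) ⟩
      0ℚ + sum (λ i → inv (2 ℕ.+ (i ℕ.+ m))) d               ≤⟨ +-monoˡ-≤ _ (0≤sum (λ i → 0≤inv (2 ℕ.+ i)) m) ⟩
      harmonic m + sum (λ i → inv (2 ℕ.+ (i ℕ.+ m))) d       ≡⟨ sym (sum-split _ d m) ⟩
      harmonic (d ℕ.+ m)                                     ∎)
    where open ≤-Reasoning

  p≤∣p∣ : ∀ p → p ≤ ∣ p ∣
  p≤∣p∣ p with ≤-total 0ℚ p
  ... | inj₁ 0≤p = ≤-reflexive (sym (0≤p⇒∣p∣≡p 0≤p))
  ... | inj₂ p≤0 = ≤-trans p≤0 (0≤∣p∣ p)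

  p<p+q : ∀ p {q} → 0ℚ < q → p < p + q
  p<p+q p {q} 0<q = subst (_< p + q) (+-identityʳ p) (+-monoʳ-< p 0<q)

  -- The coefficients as functions of t.

  -- coeff t n is cₙ₊₁.
  coeff : ℚ → ℕ → ℚ
  coeff t zero    = 1ℚ
  coeff t (suc n) = coeff t n * (1ℚ - t * inv (2 ℕ.+ n))

  coeff-bound : ℚ → ℕ → ℚ
  coeff-bound B zero    = 1ℚ
  coeff-bound B (suc n) = coeff-bound B n * (1ℚ + B)

  -- Each factor is at most 1 + |t| / (n + 2), hence at most 1 + B. The bound depends on B alone, so
  -- it holds for all approximations of λ + 1 at once.
  ∣coeff∣≤bound : ∀ {t B} → ∣ t ∣ ≤ B → ∀ n → ∣ coeff t n ∣ ≤ coeff-bound B n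
  ∣coeff∣≤bound         ∣t∣≤B zero    = ≤-refl
  ∣coeff∣≤bound {t} {B} ∣t∣≤B (suc n) = begin
    ∣ coeff t n * (1ℚ - t * i) ∣      ≡⟨ ∣p*q∣≡∣p∣*∣q∣ (coeff t n) (1ℚ - t * i) ⟩
    ∣ coeff t n ∣ * ∣ 1ℚ - t * i ∣    ≤⟨ *-mono (≤-trans (0≤∣p∣ (coeff t n)) IH) (0≤∣p∣ (1ℚ - t * i)) IH factor ⟩
    coeff-bound B n * (1ℚ + B)        ∎
    where
    open ≤-Reasoning
    i = inv (2 ℕ.+ n)
    IH = ∣coeff∣≤bound {t} ∣t∣≤B n
    factor : ∣ 1ℚ - t * i ∣ ≤ 1ℚ + B
    factor = begin
      ∣ 1ℚ - t * i ∣         ≤⟨ ∣p-q∣≤∣p∣+∣q∣ 1ℚ (t * i) ⟩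
      1ℚ + ∣ t * i ∣         ≡⟨ cong (1ℚ +_) (∣p*q∣≡∣p∣*∣q∣ t i) ⟩
      1ℚ + ∣ t ∣ * ∣ i ∣     ≡⟨ cong (λ x → 1ℚ + ∣ t ∣ * x) (0≤p⇒∣p∣≡p (0≤inv (2 ℕ.+ n))) ⟩
      1ℚ + ∣ t ∣ * i         ≤⟨ +-monoʳ-≤ 1ℚ (*-mono (≤-trans (0≤∣p∣ t) ∣t∣≤B) (0≤inv (2 ℕ.+ n)) ∣t∣≤B (inv≤1 (2 ℕ.+ n))) ⟩
      1ℚ + B * 1ℚ            ≡⟨ cong (1ℚ +_) (*-identityʳ B) ⟩
      1ℚ + B                 ∎

  -- For t ≤ 0 every factor 1 - t / (n + 2) is at least 1.
  1≤coeff : ∀ {t} → t ≤ 0ℚ → ∀ n → 1ℚ ≤ coeff t n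
  1≤coeff     t≤0 zero    = ≤-refl
  1≤coeff {t} t≤0 (suc n) = *-mono (≤-trans (nonNegative⁻¹ 1ℚ) IH) (nonNegative⁻¹ 1ℚ) IH (begin
    1ℚ                ≡⟨⟩
    1ℚ - 0ℚ           ≤⟨ +-monoʳ-≤ 1ℚ (neg-antimono-≤ (begin
      t * i             ≤⟨ *-monoʳ-≤-nonNeg i {{nonNegative (0≤inv (2 ℕ.+ n))}} t≤0 ⟩
      0ℚ * i            ≡⟨ *-zeroˡ i ⟩
      0ℚ                ∎)) ⟩
    1ℚ - t * i        ∎)
    where
    open ≤-Reasoning
    i = inv (2 ℕ.+ n)
    IH = 1≤coeff t≤0 n

  -- By the recurrence, t times the summand at n is `coeff t n` minus `coeff t (suc n)`.
  coeff-telescope : ∀ t n → t * sum (λ i → coeff t i * inv (2 ℕ.+ i)) n ≡ 1ℚ - coeff t n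
  coeff-telescope t zero    = *-zeroʳ t
  coeff-telescope t (suc n) = begin
    t * (sum f n + c * i)        ≡⟨ *-distribˡ-+ t (sum f n) (c * i) ⟩
    t * sum f n + t * (c * i)    ≡⟨ cong (_+ t * (c * i)) (coeff-telescope t n) ⟩
    1ℚ - c + t * (c * i)         ≡⟨ solve 3 (λ t c i → con 1ℚ :- c :+ t :* (c :* i) := con 1ℚ :- c :* (con 1ℚ :- t :* i)) refl t c i ⟩
    1ℚ - c * (1ℚ - t * i)        ∎
    where
    open ≡-Reasoning
    f = λ i → coeff t i * inv (2 ℕ.+ i)
    c = coeff t n
    i = inv (2 ℕ.+ n)

  *-pos : ∀ {p q} → 0ℚ < p → 0ℚ < q → 0ℚ < p * q
  *-pos {p} {q} 0<p 0<q = positive⁻¹ (p * q) {{pos*pos⇒pos p {{positive 0<p}} q {{positive 0<q}}}}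

  -- Decay of the coefficients for t ≥ δ > 0.

  module Decay {δ t : ℚ} (N : ℕ) (0<δ : 0ℚ < δ) (δ≤t : δ ≤ t) (t≤N : t ≤ nat N) where

    private
      0≤δ = <⇒≤ 0<δ

    size : ℕ → ℚ
    size n = ∣ coeff t n ∣

    0≤size*inv : ∀ n → 0ℚ ≤ size n * inv (2 ℕ.+ n)
    0≤size*inv n = nonNegative⁻¹ _
      {{nonNeg*nonNeg⇒nonNeg (size n) {{∣-∣-nonNeg (coeff t n)}} (inv (2 ℕ.+ n)) {{nonNegative (0≤inv (2 ℕ.+ n))}}}}

    -- As t ≤ N ≤ n, the factor 1 - t / (n + 2) is nonnegative, and the size drops by exactly t
    -- times the weighted size. Replacing t by δ makes the estimate common to all admissible t.
    size-step : ∀ n → N ℕ.≤ n → size (suc n) + δ * (size n * inv (2 ℕ.+ n)) ≤ size n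
    size-step n N≤n = begin
      ∣ coeff t n * (1ℚ - t * i) ∣ + δ * (size n * i)
        ≡⟨ cong (_+ δ * (size n * i)) (∣p*q∣≡∣p∣*∣q∣ (coeff t n) (1ℚ - t * i)) ⟩
      size n * ∣ 1ℚ - t * i ∣ + δ * (size n * i)
        ≡⟨ cong (λ x → size n * x + δ * (size n * i)) (0≤p⇒∣p∣≡p 0≤factor) ⟩
      size n * (1ℚ - t * i) + δ * (size n * i)
        ≤⟨ +-monoʳ-≤ (size n * (1ℚ - t * i)) (*-monoʳ-≤-nonNeg (size n * i) {{nonNegative (0≤size*inv n)}} δ≤t) ⟩
      size n * (1ℚ - t * i) + t * (size n * i)
        ≡⟨ solve 3 (λ s t i → s :* (con 1ℚ :- t :* i) :+ t :* (s :* i) := s) refl (size n) t i ⟩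
      size n ∎
      where
      open ≤-Reasoning
      i = inv (2 ℕ.+ n)
      t*i≤1 : t * i ≤ 1ℚ
      t*i≤1 = ≤-trans
        (*-monoʳ-≤-nonNeg i {{nonNegative (0≤inv (2 ℕ.+ n))}}
          (≤-trans t≤N (nat-mono (ℕ.≤-trans N≤n (ℕ.m≤n+m n 2)))))
        (≤-reflexive (nat-*-inv (2 ℕ.+ n)))
      0≤factor : 0ℚ ≤ 1ℚ - t * i
      0≤factor = ≤-trans (≤-reflexive (sym (+-inverseʳ (t * i)))) (+-monoˡ-≤ (- (t * i)) t*i≤1)

    size-antimono : ∀ {m n} → N ℕ.≤ m → m ℕ.≤′ n → size n ≤ size m
    size-antimono N≤m ℕ.≤′-refl = ≤-refl
    size-antimono {m} {suc n} N≤m (ℕ.≤′-step m≤n) = begin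
      size (suc n)                                     ≡⟨ sym (+-identityʳ (size (suc n))) ⟩
      size (suc n) + 0ℚ                                ≤⟨ +-monoʳ-≤ (size (suc n)) (≤-trans (≤-reflexive (sym (*-zeroʳ δ))) (*-monoˡ-≤-nonNeg δ {{nonNegative 0≤δ}} (0≤size*inv n))) ⟩
      size (suc n) + δ * (size n * inv (2 ℕ.+ n))      ≤⟨ size-step n (ℕ.≤-trans N≤m (ℕ.≤′⇒≤ m≤n)) ⟩
      size n                                           ≤⟨ size-antimono {m} N≤m m≤n ⟩
      size m                                           ∎
      where open ≤-Reasoning

    -- The drops of `size-step` accumulate over d indices. This one inequality yields both the
    -- vanishing of the coefficients and the tail bound for the zeta series.
    size-sum : ∀ m d → N ℕ.≤ m →
      size (d ℕ.+ m) + δ * sum (λ i → size (i ℕ.+ m) * inv (2 ℕ.+ (i ℕ.+ m))) d ≤ size m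
    size-sum m zero    N≤m = ≤-reflexive (trans (cong (size m +_) (*-zeroʳ δ)) (+-identityʳ (size m)))
    size-sum m (suc d) N≤m = begin
      size (suc d ℕ.+ m) + δ * (W + w)
        ≡⟨ solve 4 (λ s δ W w → s :+ δ :* (W :+ w) := (s :+ δ :* w) :+ δ :* W) refl (size (suc d ℕ.+ m)) δ W w ⟩
      (size (suc d ℕ.+ m) + δ * w) + δ * W
        ≤⟨ +-monoˡ-≤ (δ * W) (size-step (d ℕ.+ m) (ℕ.≤-trans N≤m (ℕ.m≤n+m m d))) ⟩
      size (d ℕ.+ m) + δ * W
        ≤⟨ size-sum m d N≤m ⟩
      size m ∎
      where
      open ≤-Reasoning
      W = sum (λ i → size (i ℕ.+ m) * inv (2 ℕ.+ (i ℕ.+ m))) d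
      w = size (d ℕ.+ m) * inv (2 ℕ.+ (d ℕ.+ m))

    size-weighted-sum : ∀ m d → N ℕ.≤ m →
      δ * sum (λ i → size (i ℕ.+ m) * inv (2 ℕ.+ (i ℕ.+ m))) d ≤ size m
    size-weighted-sum m d N≤m = ≤-trans
      (≤-trans (≤-reflexive (sym (+-identityˡ _))) (+-monoˡ-≤ _ (0≤∣p∣ (coeff t (d ℕ.+ m)))))
      (size-sum m d N≤m)

    -- Sizes decrease from N on, so every size in the weighted sum may be lowered to the last one.
    -- The divergent harmonic factor then forces that last size to be small.
    size-*-harmonic : ∀ m d → N ℕ.≤ m →
      size (d ℕ.+ m) * (δ * sum (λ i → inv (2 ℕ.+ (i ℕ.+ m))) d) ≤ size m
    size-*-harmonic m d N≤m = begin
      size (d ℕ.+ m) * (δ * H)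
        ≡⟨ solve 3 (λ s δ H → s :* (δ :* H) := δ :* (s :* H)) refl (size (d ℕ.+ m)) δ H ⟩
      δ * (size (d ℕ.+ m) * H)
        ≡⟨ cong (δ *_) (sym (sum-scale (size (d ℕ.+ m)) (λ i → inv (2 ℕ.+ (i ℕ.+ m))) d)) ⟩
      δ * sum (λ i → size (d ℕ.+ m) * inv (2 ℕ.+ (i ℕ.+ m))) d
        ≤⟨ *-monoˡ-≤-nonNeg δ {{nonNegative 0≤δ}} (sum-mono d λ i i≤d →
             *-monoʳ-≤-nonNeg (inv (2 ℕ.+ (i ℕ.+ m))) {{nonNegative (0≤inv (2 ℕ.+ (i ℕ.+ m)))}}
               (size-antimono (ℕ.≤-trans N≤m (ℕ.m≤n+m m i)) (ℕ.≤⇒≤′ (ℕ.+-monoˡ-≤ m i≤d)))) ⟩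
      δ * sum (λ i → size (i ℕ.+ m) * inv (2 ℕ.+ (i ℕ.+ m))) d
        ≤⟨ size-weighted-sum m d N≤m ⟩
      size m ∎
      where
      open ≤-Reasoning
      H = sum (λ i → inv (2 ℕ.+ (i ℕ.+ m))) d

  -- With n = i + 1 and s = r + 2 this is aₙ / nˢ, one power of n being already contained in cₙ.
  ζ-summand : ℚ → ℕ → ℕ → ℚ
  ζ-summand t r i = coeff t i * inv (suc i ℕ.^ suc r) {{ℕ.m^n≢0 (suc i) (suc r)}}

  -- With n = i + 1, both n ≤ n^(r+1) and n + 1 ≤ 2n hold. This brings the zeta series under the
  -- weights of `size-sum`.
  ½∣ζ-summand∣≤ : ∀ t r i → ½ * ∣ ζ-summand t r i ∣ ≤ ∣ coeff t i ∣ * inv (2 ℕ.+ i)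
  ½∣ζ-summand∣≤ t r i = begin
    ½ * ∣ coeff t i * w ∣          ≡⟨ cong (½ *_) (∣p*q∣≡∣p∣*∣q∣ (coeff t i) w) ⟩
    ½ * (∣ coeff t i ∣ * ∣ w ∣)    ≡⟨ cong (λ x → ½ * (∣ coeff t i ∣ * x)) (0≤p⇒∣p∣≡p (0≤inv (suc i ℕ.^ suc r))) ⟩
    ½ * (∣ coeff t i ∣ * w)        ≡⟨ solve 3 (λ h c w → h :* (c :* w) := c :* (h :* w)) refl ½ ∣ coeff t i ∣ w ⟩
    ∣ coeff t i ∣ * (½ * w)        ≤⟨ *-monoˡ-≤-nonNeg ∣ coeff t i ∣ {{∣-∣-nonNeg (coeff t i)}} ½w≤ ⟩
    ∣ coeff t i ∣ * inv (2 ℕ.+ i)  ∎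
    where
    open ≤-Reasoning
    instance
      _ = ℕ.m^n≢0 (suc i) r
      _ = ℕ.m^n≢0 (suc i) (suc r)
    w = inv (suc i ℕ.^ suc r)
    ½w≤ : ½ * w ≤ inv (2 ℕ.+ i)
    ½w≤ = begin
      ½ * w                ≤⟨ *-monoˡ-≤-nonNeg ½ (inv-antimono (suc i) (suc i ℕ.^ suc r) (ℕ.m≤m*n (suc i) (suc i ℕ.^ r))) ⟩
      ½ * inv (suc i)      ≡⟨ trans (cong (_* inv (suc i)) (sym (inv-def 2))) (sym (inv-* 2 (suc i))) ⟩
      inv (2 ℕ.* suc i)    ≤⟨ inv-antimono (2 ℕ.+ i) (2 ℕ.* suc i) (ℕ.+-monoʳ-≤ 1 (ℕ.≤-trans (ℕ.m≤m+n (suc i) 0) (ℕ.m≤n+m (suc i ℕ.+ 0) i))) ⟩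
      inv (2 ℕ.+ i)        ∎

  -- Here s = 2, and cₙ / n ≥ 1 / n ≥ 1 / (n + 1) because all coefficients are at least 1.
  harmonic≤ζ-partial : ∀ {t} → t ≤ 0ℚ → ∀ n → harmonic n ≤ sum (ζ-summand t 0) n
  harmonic≤ζ-partial {t} t≤0 n = sum-mono n λ i _ → begin
    inv (2 ℕ.+ i)                                     ≡⟨ sym (*-identityˡ (inv (2 ℕ.+ i))) ⟩
    1ℚ * inv (2 ℕ.+ i)                                ≤⟨ *-mono (≤-trans (nonNegative⁻¹ 1ℚ) (1≤coeff t≤0 i)) (0≤inv (2 ℕ.+ i)) (1≤coeff t≤0 i)
                                                           (inv-antimono (suc i ℕ.^ 1) (2 ℕ.+ i) {{ℕ.m^n≢0 (suc i) 1}}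
                                                             (ℕ.≤-trans (ℕ.≤-reflexive (ℕ.*-identityʳ (suc i))) (ℕ.n≤1+n (suc i)))) ⟩
    ζ-summand t 0 i ∎
    where open ≤-Reasoning

  -- Estimates uniform over δ ≤ t ≤ B.

  module _ {δ B : ℚ} (0<δ : 0ℚ < δ) where

    -- M is chosen before t, since the approximations of λ + 1 range over the whole interval. The
    -- bound B ≤ M lets M serve again as the starting index of `Decay`.
    coeff-vanishes : ∀ ε → 0ℚ < ε → ∃[ M ] B ≤ nat M ×
      (∀ t → δ ≤ t → t ≤ B → ∀ n → M ℕ.≤ n → ∣ coeff t n ∣ < ε)
    coeff-vanishes ε 0<ε =
      let N , B≤N = archimedean B
          K = coeff-bound B N
          δε = δ * ε
          0<δε = *-pos 0<δ 0<ε
          instance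
            δε⁺ = positive 0<δε
            δε≢0 = pos⇒nonZero δε
          -- Chosen so that δ ε X = K + 1, which exceeds the size at N; a harmonic sum of at least X
          -- then pushes the size below ε.
          X = 1/ δε * (K + 1ℚ)
          d , X≤H = harmonic-diverges N X
      in d ℕ.+ N , ≤-trans B≤N (nat-mono (ℕ.m≤n+m N d)) , λ t δ≤t t≤B n M≤n →
        let open Decay N 0<δ δ≤t (≤-trans t≤B B≤N)
            open ≤-Reasoning
            H = sum (λ i → inv (2 ℕ.+ (i ℕ.+ N))) d
            0≤H = 0≤sum (λ i → 0≤inv (2 ℕ.+ (i ℕ.+ N))) d
            δH⁺ = nonNeg*nonNeg⇒nonNeg δ {{nonNegative (<⇒≤ 0<δ)}} H {{nonNegative 0≤H}}
        in ≤-<-trans (size-antimono (ℕ.m≤n+m N d) (ℕ.≤⇒≤′ M≤n))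
          (*-cancelʳ-<-nonNeg (δ * H) {{δH⁺}} (begin-strict
            size (d ℕ.+ N) * (δ * H)  ≤⟨ size-*-harmonic N d ℕ.≤-refl ⟩
            size N                    ≤⟨ ∣coeff∣≤bound {t} (subst (_≤ B) (sym (0≤p⇒∣p∣≡p (≤-trans (<⇒≤ 0<δ) δ≤t))) t≤B) N ⟩
            K                         ≡⟨ sym (+-identityʳ K) ⟩
            K + 0ℚ                    <⟨ +-monoʳ-< K (positive⁻¹ 1ℚ) ⟩
            K + 1ℚ                    ≡⟨ sym (*-identityˡ (K + 1ℚ)) ⟩
            1ℚ * (K + 1ℚ)             ≡⟨ cong (_* (K + 1ℚ)) (sym (*-inverseʳ δε)) ⟩
            δε * 1/ δε * (K + 1ℚ)     ≡⟨ *-assoc δε (1/ δε) (K + 1ℚ) ⟩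
            δε * X                    ≤⟨ *-monoˡ-≤-nonNeg δε {{pos⇒nonNeg δε}} X≤H ⟩
            δε * H                    ≡⟨ solve 3 (λ δ ε H → δ :* ε :* H := ε :* (δ :* H)) refl δ ε H ⟩
            ε * (δ * H)               ∎))

    ζ-partial-cauchy : ∀ r ε → 0ℚ < ε → ∃[ M ] (∀ t → δ ≤ t → t ≤ B → ∀ d →
      ∣ sum (ζ-summand t r) (d ℕ.+ M) - sum (ζ-summand t r) M ∣ < ε)
    ζ-partial-cauchy r ε 0<ε =
      let 0<½δε = *-pos (half 0<δ) 0<ε
          -- The tail multiplied by ½ δ is at most the size at M, hence this threshold.
          M , B≤M , small = coeff-vanishes (½ * δ * ε) 0<½δε
      in M , λ t δ≤t t≤B d →
        let open Decay M 0<δ δ≤t (≤-trans t≤B B≤M)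
            open ≤-Reasoning
            z = ζ-summand t r
            W = sum (λ i → size (i ℕ.+ M) * inv (2 ℕ.+ (i ℕ.+ M))) d
        in *-cancelˡ-<-nonNeg (½ * δ) {{nonNegative (<⇒≤ (half 0<δ))}} (begin-strict
          ½ * δ * ∣ sum z (d ℕ.+ M) - sum z M ∣
            ≡⟨ cong (λ x → ½ * δ * ∣ x - sum z M ∣) (sum-split z d M) ⟩
          ½ * δ * ∣ sum z M + sum (λ i → z (i ℕ.+ M)) d - sum z M ∣
            ≡⟨ cong (λ x → ½ * δ * ∣ x ∣) (solve 2 (λ a b → a :+ b :- a := b) refl (sum z M) (sum (λ i → z (i ℕ.+ M)) d)) ⟩
          ½ * δ * ∣ sum (λ i → z (i ℕ.+ M)) d ∣
            ≡⟨ solve 3 (λ h δ x → h :* δ :* x := δ :* (h :* x)) refl ½ δ ∣ sum (λ i → z (i ℕ.+ M)) d ∣ ⟩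
          δ * (½ * ∣ sum (λ i → z (i ℕ.+ M)) d ∣)
            ≤⟨ *-monoˡ-≤-nonNeg δ {{nonNegative (<⇒≤ 0<δ)}} (begin
                 ½ * ∣ sum (λ i → z (i ℕ.+ M)) d ∣
                   ≤⟨ *-monoˡ-≤-nonNeg ½ (∣sum∣≤sum∣∣ (λ i → z (i ℕ.+ M)) d) ⟩
                 ½ * sum (λ i → ∣ z (i ℕ.+ M) ∣) d
                   ≡⟨ sym (sum-scale ½ (λ i → ∣ z (i ℕ.+ M) ∣) d) ⟩
                 sum (λ i → ½ * ∣ z (i ℕ.+ M) ∣) d
                   ≤⟨ sum-mono d (λ i _ → ½∣ζ-summand∣≤ t r (i ℕ.+ M)) ⟩
                 W ∎) ⟩
          δ * W           ≤⟨ size-weighted-sum M d ℕ.≤-refl ⟩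
          size M          <⟨ small t δ≤t t≤B M ℕ.≤-refl ⟩
          ½ * δ * ε       ∎)

  -- Partial fractions and the telescoping series.

  sum-cong : ∀ {f g} → (∀ i → f i ≡ g i) → ∀ n → sum f n ≡ sum g n
  sum-cong f≡g zero    = refl
  sum-cong f≡g (suc n) = cong₂ _+_ (sum-cong f≡g n) (f≡g n)

  sum-sub : ∀ f g n → sum (λ i → f i - g i) n ≡ sum f n - sum g n
  sum-sub f g zero    = refl
  sum-sub f g (suc n) = trans (cong (_+ (f n - g n)) (sum-sub f g n))
    (solve 4 (λ a b c d → a :- b :+ (c :- d) := a :+ c :- (b :+ d)) refl (sum f n) (sum g n) (f n) (g n))

  sum-head : ∀ f n → sum f (suc n) ≡ f 0 + sum (λ i → f (suc i)) n
  sum-head f zero    = +-comm 0ℚ (f 0)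
  sum-head f (suc n) = trans (cong (_+ f (suc n)) (sum-head f n)) (+-assoc (f 0) _ (f (suc n)))

  -- With n = i + 1 and p = r + 1 this is aₙ / (nᵖ (n + 1)); r = 0 is the telescoping case.
  shifted-summand : ℚ → ℕ → ℕ → ℚ
  shifted-summand t r i = coeff t i * inv (suc i ℕ.^ r) {{ℕ.m^n≢0 (suc i) r}} * inv (2 ℕ.+ i)

  shifted-suc : ∀ t r i → shifted-summand t (suc r) i ≡ ζ-summand t r i - shifted-summand t r i
  shifted-suc t r i = begin
    c * w * v                                  ≡⟨ cong (λ x → c * x * v) w≡ ⟩
    -- The factor 1 = (n + 1) - n is inserted; afterwards (n + 1) v and n u cancel to 1.
    c * (u * y) * v                            ≡⟨ solve 5 (λ c u y v n → c :* (u :* y) :* v := c :* (u :* y) :* ((n :+ con 1ℚ) :* v) :- c :* (n :* u :* y) :* v) refl c u y v n ⟩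
    c * (u * y) * ((n + 1ℚ) * v) - c * (n * u * y) * v
      ≡⟨ cong₂ (λ a b → c * (u * y) * a - c * (b * y) * v)
           (trans (cong (_* v) (sym (nat-suc (suc i)))) (nat-*-inv (2 ℕ.+ i))) (nat-*-inv (suc i)) ⟩
    c * (u * y) * 1ℚ - c * (1ℚ * y) * v        ≡⟨ solve 4 (λ c u y v → c :* (u :* y) :* con 1ℚ :- c :* (con 1ℚ :* y) :* v := c :* (u :* y) :- c :* y :* v) refl c u y v ⟩
    c * (u * y) - c * y * v                    ≡⟨ cong (λ x → c * x - c * y * v) (sym w≡) ⟩
    c * w - c * y * v                          ∎
    where
    open ≡-Reasoning
    instance
      _ = ℕ.m^n≢0 (suc i) r
      _ = ℕ.m^n≢0 (suc i) (suc r)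
    c = coeff t i
    n = nat (suc i)
    u = inv (suc i)
    v = inv (2 ℕ.+ i)
    y = inv (suc i ℕ.^ r)
    w = inv (suc i ℕ.^ suc r)
    w≡ : w ≡ u * y
    w≡ = inv-* (suc i) (suc i ℕ.^ r)

  -- Telescoping gives t S = 1 - `coeff t n`, while t s = 1, so the error is |`coeff t n`| / |t|.
  shifted-partial-error : ∀ {t s ε} → s * t ≡ 1ℚ → ∀ n → ∣ coeff t n ∣ < ε * ∣ t ∣ →
    ∣ sum (shifted-summand t 0) n - s ∣ < ε
  shifted-partial-error {t} {s} {ε} st≡1 n small =
    *-cancelʳ-<-nonNeg ∣ t ∣ {{∣-∣-nonNeg t}} (begin-strict
      ∣ S - s ∣ * ∣ t ∣        ≡⟨ sym (∣p*q∣≡∣p∣*∣q∣ (S - s) t) ⟩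
      ∣ (S - s) * t ∣          ≡⟨ cong ∣_∣ (solve 3 (λ S s t → (S :- s) :* t := t :* S :- s :* t) refl S s t) ⟩
      ∣ t * S - s * t ∣        ≡⟨ cong₂ (λ a b → ∣ a - b ∣) tS≡ st≡1 ⟩
      ∣ 1ℚ - c - 1ℚ ∣          ≡⟨ cong ∣_∣ (solve 1 (λ c → con 1ℚ :- c :- con 1ℚ := :- c) refl c) ⟩
      ∣ - c ∣                  ≡⟨ ∣-p∣≡∣p∣ c ⟩
      ∣ c ∣                    <⟨ small ⟩
      ε * ∣ t ∣                ∎)
    where
    open ≤-Reasoning
    S = sum (shifted-summand t 0) n
    c = coeff t n
    tS≡ : t * S ≡ 1ℚ - c
    tS≡ = trans
      (cong (t *_) (sum-cong (λ i → cong (_* inv (2 ℕ.+ i)) (trans (cong (coeff t i *_) (inv-def 1)) (*-identityʳ (coeff t i)))) n))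
      (coeff-telescope t n)

  inv-cong : ∀ {m n} .{{_ : NonZero m}} .{{_ : NonZero n}} → m ≡ n → inv m ≡ inv n
  inv-cong refl = refl

open import Defs
open import Data.Empty using (⊥)
open import Data.Nat.Base as ℕ using (ℕ; zero; suc; _≤_; _∸_; NonZero; z≤n; s≤s; _!)
import Data.Nat.Properties as ℕ
open import Data.Product.Base using (∃-syntax; _×_; _,_)
open import Data.Rational as ℚ using (ℚ; 0ℚ; 1ℚ)
import Data.Rational.Properties as ℚ
open import Data.Rational.Solver using (module +-*-Solver)
open import Data.Sum.Base using (inj₁; inj₂)
open import Relation.Binary.PropositionalEquality
open import Relation.Nullary.Negation.Core using (¬_; contradiction)

open RationalEstimates
open +-*-Solver

-- Limits of reals tested on rational approximations.

-- A record, so that the limit can be inferred from the type: comparing two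
-- expressions for a real otherwise tends to unfold their Cauchy proofs.
record _⟶ℚ_ (x : ℕ → ℝ) (L : ℝ) : Set where
  constructor limit
  field
    close : ∀ ε → 0ℚ ℚ.< ε → ∃[ N ] ∀ n → N ≤ n →
      ∃[ J ] ∀ j → J ≤ j → ℚ.∣ approx (x n) j ℚ.- approx L j ∣ ℚ.< ε

open _⟶ℚ_

⟶ℚ⇒⟶ : ∀ {x L} → x ⟶ℚ L → x ⟶ L
⟶ℚ⇒⟶ {x} {L} x⟶L ε 0<ε =
  let N , h = close x⟶L (ℚ.½ ℚ.* ε) (half 0<ε)
  in N , λ n N≤n →
    let J , k = h n N≤n
    -- A strict inequality of reals demands a positive rational gap; half of ε is kept back for it.
    in ℚ.½ ℚ.* ε , half 0<ε , J , λ j J≤j →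
      subst (ℚ.∣ approx (x n) j ℚ.- approx L j ∣ ℚ.+ ℚ.½ ℚ.* ε ℚ.<_) (half+half ε)
        (ℚ.+-monoˡ-< (ℚ.½ ℚ.* ε) (k j J≤j))

⟶⇒⟶ℚ : ∀ {x L} → x ⟶ L → x ⟶ℚ L
⟶⇒⟶ℚ {x} {L} x⟶L = limit λ ε 0<ε →
  let N , h = x⟶L ε 0<ε
  in N , λ n N≤n →
    let δ , 0<δ , J , k = h n N≤n
    in J , λ j J≤j → ℚ.<-trans
      (p<p+q ℚ.∣ approx (x n) j ℚ.- approx L j ∣ 0<δ) (k j J≤j)

∣-∣-sum : ∀ a b {ε} → ℚ.∣ a ∣ ℚ.< ℚ.½ ℚ.* ε → ℚ.∣ b ∣ ℚ.< ℚ.½ ℚ.* ε → ℚ.∣ a ℚ.+ b ∣ ℚ.< ε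
∣-∣-sum a b {ε} p q = ℚ.≤-<-trans (ℚ.∣p+q∣≤∣p∣+∣q∣ a b)
  (subst (ℚ.∣ a ∣ ℚ.+ ℚ.∣ b ∣ ℚ.<_) (half+half ε) (ℚ.+-mono-< p q))

∣-∣-difference : ∀ a b {ε} → ℚ.∣ a ∣ ℚ.< ℚ.½ ℚ.* ε → ℚ.∣ b ∣ ℚ.< ℚ.½ ℚ.* ε → ℚ.∣ a ℚ.- b ∣ ℚ.< ε
∣-∣-difference a b p q = ∣-∣-sum a (ℚ.- b) p (subst (ℚ._< _) (sym (ℚ.∣-p∣≡∣p∣ b)) q)

-- The identity for z is required only from J on, because the series take their rational form only
-- where the approximations of λ stay away from 0.
⟶-difference : ∀ {x y z L M K} → x ⟶ℚ L → y ⟶ℚ M → ∀ J →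
  (∀ n j → J ≤ j → approx (z n) j ≡ approx (x n) j ℚ.- approx (y n) j) →
  (∀ j → approx K j ≡ approx L j ℚ.- approx M j) → z ⟶ℚ K
⟶-difference {x} {y} {z} {L} {M} {K} x⟶L y⟶M J z≡ K≡ = limit λ ε 0<ε →
  let P , p = close x⟶L (ℚ.½ ℚ.* ε) (half 0<ε)
      Q , q = close y⟶M (ℚ.½ ℚ.* ε) (half 0<ε)
  in P ℕ.⊔ Q , λ n ≤n →
    let I₁ , p′ = p n (ℕ.m⊔n≤o⇒m≤o P Q ≤n)
        I₂ , q′ = q n (ℕ.m⊔n≤o⇒n≤o P Q ≤n)
    in (I₁ ℕ.⊔ I₂) ℕ.⊔ J , λ j ≤j →
      let ≤j′ = ℕ.m⊔n≤o⇒m≤o (I₁ ℕ.⊔ I₂) J ≤j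
          a = approx (x n) j
          b = approx L j
          c = approx (y n) j
          d = approx M j
      in subst (λ e → ℚ.∣ e ∣ ℚ.< ε)
           (trans (solve 4 (λ a b c d → (a :- b) :- (c :- d) := (a :- c) :- (b :- d)) refl a b c d)
             (sym (cong₂ ℚ._-_ (z≡ n j (ℕ.m⊔n≤o⇒n≤o (I₁ ℕ.⊔ I₂) J ≤j)) (K≡ j))))
           (∣-∣-difference (a ℚ.- b) (c ℚ.- d)
             (p′ j (ℕ.m⊔n≤o⇒m≤o I₁ I₂ ≤j′)) (q′ j (ℕ.m⊔n≤o⇒n≤o I₁ I₂ ≤j′)))

-- A limit is eventually bounded by some C, so late terms stay below 1 + C at late indices, whereas
-- f reaches 1 + C.
unbounded⇒¬⟶ : ∀ x L J (f : ℕ → ℚ) → (∀ N B → ∃[ d ] B ℚ.≤ f (d ℕ.+ N)) →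
  (∀ n j → J ≤ j → f n ℚ.≤ approx (x n) j) → ¬ (x ⟶ℚ L)
unbounded⇒¬⟶ x L J f unbounded f≤x x⟶L =
  let N , h = close x⟶L 1ℚ (ℚ.positive⁻¹ 1ℚ)
      C , _ , K , ∣L∣≤C = eventually-bounded L
      d , 1+C≤f = unbounded N (1ℚ ℚ.+ C)
      I , near = h (d ℕ.+ N) (ℕ.m≤n+m N d)
      j = (I ℕ.⊔ J) ℕ.⊔ K
  in contradict C (d ℕ.+ N) j 1+C≤f
       (f≤x (d ℕ.+ N) j (ℕ.≤-trans (ℕ.m≤n⊔m I J) (ℕ.m≤m⊔n (I ℕ.⊔ J) K)))
       (near j (ℕ.≤-trans (ℕ.m≤m⊔n I J) (ℕ.m≤m⊔n (I ℕ.⊔ J) K)))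
       (∣L∣≤C j (ℕ.m≤n⊔m (I ℕ.⊔ J) K))
  where
  contradict : ∀ C n j → 1ℚ ℚ.+ C ℚ.≤ f n → f n ℚ.≤ approx (x n) j →
    ℚ.∣ approx (x n) j ℚ.- approx L j ∣ ℚ.< 1ℚ → ℚ.∣ approx L j ∣ ℚ.≤ C → ⊥
  contradict C n j 1+C≤f f≤x near ∣L∣≤C = ℚ.<-irrefl refl (begin-strict
    1ℚ ℚ.+ C                                                    ≤⟨ 1+C≤f ⟩
    f n                                                         ≤⟨ f≤x ⟩
    approx (x n) j                                              ≤⟨ p≤∣p∣ (approx (x n) j) ⟩
    ℚ.∣ approx (x n) j ∣                                        ≤⟨ ∣-∣-triangle⁻ (approx (x n) j) (approx L j) ⟩
    ℚ.∣ approx (x n) j ℚ.- approx L j ∣ ℚ.+ ℚ.∣ approx L j ∣    <⟨ ℚ.+-mono-<-≤ near ∣L∣≤C ⟩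
    1ℚ ℚ.+ C                                                    ∎)
    where open ℚ.≤-Reasoning

-- When S is Cauchy uniformly in the index of the rational approximations,
-- the diagonal approximations are themselves a Cauchy sequence.
uniform-limit : ∀ (S : ℕ → ℝ) J →
  (∀ ε → 0ℚ ℚ.< ε → ∃[ M ] ∀ n j → M ≤ n → J ≤ j → ℚ.∣ approx (S n) j ℚ.- approx (S M) j ∣ ℚ.< ε) →
  ∃[ L ] S ⟶ℚ L
uniform-limit S J uniform = L , limit λ ε 0<ε →
  let M , h = uniform (ℚ.½ ℚ.* ε) (half 0<ε)
  -- The approximation of L at j is that of `S j`, so j acts as a term number too and must pass M as
  -- well as J.
  in M , λ n M≤n → M ℕ.⊔ J , λ j ≤j →
    let M≤j = ℕ.m⊔n≤o⇒m≤o M J ≤j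
        J≤j = ℕ.m⊔n≤o⇒n≤o M J ≤j
        b = approx (S M) j
    in subst (λ e → ℚ.∣ e ∣ ℚ.< ε)
         (solve 3 (λ a b c → (a :- b) :- (c :- b) := a :- c) refl (approx (S n) j) b (approx (S j) j))
         (∣-∣-difference (approx (S n) j ℚ.- b) (approx (S j) j ℚ.- b) (h n j M≤n J≤j) (h j j M≤j J≤j))
  where
  L : ℝ
  L = mkℝ (λ n → approx (S n) n) λ ε 0<ε →
    -- Each diagonal entry is compared with `S M` at its own index at a cost of ε / 4; the other ε /
    -- 2 pays for the variation of `S M` between the two indices.
    let M , h = uniform (ℚ.½ ℚ.* (ℚ.½ ℚ.* ε)) (half (half 0<ε))
        N , k = cauchy (S M) (ℚ.½ ℚ.* ε) (half 0<ε)
    in (M ℕ.⊔ J) ℕ.⊔ N , λ m n ≤m ≤n →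
      let M⊔J≤m = ℕ.m⊔n≤o⇒m≤o (M ℕ.⊔ J) N ≤m
          M⊔J≤n = ℕ.m⊔n≤o⇒m≤o (M ℕ.⊔ J) N ≤n
          near = λ i M⊔J≤i → h i i (ℕ.m⊔n≤o⇒m≤o M J M⊔J≤i) (ℕ.m⊔n≤o⇒n≤o M J M⊔J≤i)
          a = approx (S m) m
          b = approx (S M) m
          c = approx (S n) n
          d = approx (S M) n
      in subst (λ e → ℚ.∣ e ∣ ℚ.< ε)
           (solve 4 (λ a b c d → ((a :- b) :- (c :- d)) :+ (b :- d) := a :- c) refl a b c d)
           (∣-∣-sum ((a ℚ.- b) ℚ.- (c ℚ.- d)) (b ℚ.- d)
             (∣-∣-difference (a ℚ.- b) (c ℚ.- d) (near m M⊔J≤m) (near n M⊔J≤n))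
             (k m n (ℕ.m⊔n≤o⇒n≤o (M ℕ.⊔ J) N ≤m) (ℕ.m⊔n≤o⇒n≤o (M ℕ.⊔ J) N ≤n)))

-- Partial sums and the alternating sum at a fixed approximation index.

approx-∑ : ∀ {f : Seq} {g j} → (∀ i → approx (f (suc i)) j ≡ g i) → ∀ n → approx (∑ n f) j ≡ sum g n
approx-∑ f≡g zero    = refl
approx-∑ f≡g (suc n) = cong₂ ℚ._+_ (approx-∑ f≡g n) (f≡g n)

-- Raising p by one negates the old right-hand side and adds the zeta value Z. The sums are
-- variables here, so the solver meets only atoms.
alternating-step : ∀ {S S′ T T′ a P Y} Z → S ≡ T → S′ ≡ T′ → T ≡ Z ℚ.+ a ℚ.* T′ → a ≡ ℚ.- 1ℚ →
  S ℚ.+ a ℚ.* P ℚ.* Y ≡ Z ℚ.- (S′ ℚ.+ P ℚ.* Y)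
alternating-step {T′ = T′} {P = P} {Y} Z refl refl refl refl =
  solve 4 (λ Z T P Y → Z :+ :- con 1ℚ :* T :+ :- con 1ℚ :* P :* Y := Z :- (T :+ P :* Y)) refl Z T′ P Y

-- The new sum begins with ζ at r + 2; its remaining terms are c times the terms of the old sum.
alternating-suc : ∀ c y (ζ : ℕ → ℝ) r j → approx c j ≡ ℚ.- 1ℚ →
  approx (∑ (suc (suc r) ∸ 1) (λ k → c ^ (k ∸ 1) * ζ (suc (suc r) ∸ k ℕ.+ 1)) + c ^ (suc (suc r) ∸ 1) * y) j
    ≡ approx (ζ (suc (suc r))) j ℚ.- approx (∑ (suc r ∸ 1) (λ k → c ^ (k ∸ 1) * ζ (suc r ∸ k ℕ.+ 1)) + c ^ (suc r ∸ 1) * y) j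
alternating-suc c y ζ r j c≡-1 = alternating-step (approx (ζ (suc (suc r))) j) S≡ S′≡ T≡ c≡-1
  where
  open ≡-Reasoning
  f g : ℕ → ℚ
  f i = approx (c ^ i) j ℚ.* approx (ζ (suc r ∸ i ℕ.+ 1)) j
  g i = approx (c ^ i) j ℚ.* approx (ζ (r ∸ i ℕ.+ 1)) j
  S≡ : approx (∑ (suc (suc r) ∸ 1) (λ k → c ^ (k ∸ 1) * ζ (suc (suc r) ∸ k ℕ.+ 1))) j ≡ sum f (suc r)
  S≡ = approx-∑ (λ _ → refl) (suc r)
  S′≡ : approx (∑ (suc r ∸ 1) (λ k → c ^ (k ∸ 1) * ζ (suc r ∸ k ℕ.+ 1))) j ≡ sum g r
  S′≡ = approx-∑ (λ _ → refl) r
  T≡ : sum f (suc r) ≡ approx (ζ (suc (suc r))) j ℚ.+ approx c j ℚ.* sum g r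
  T≡ = begin
    sum f (suc r)
      ≡⟨ sum-head f r ⟩
    f 0 ℚ.+ sum (λ i → f (suc i)) r
      ≡⟨ cong₂ ℚ._+_
           (trans (ℚ.*-identityˡ (approx (ζ (suc r ℕ.+ 1)) j)) (cong (λ s → approx (ζ s) j) (ℕ.+-comm (suc r) 1)))
           (trans (sum-cong (λ i → ℚ.*-assoc (approx c j) (approx (c ^ i) j) (approx (ζ (r ∸ i ℕ.+ 1)) j)) r)
             (sum-scale (approx c j) g r)) ⟩
    approx (ζ (suc (suc r))) j ℚ.+ approx c j ℚ.* sum g r ∎

-- Denominators and numerators of the two series.

approx-/ℕ : ∀ x d .{{_ : NonZero d}} j → approx (x /ℕ d) j ≡ approx x j ℚ.* inv d
approx-/ℕ x d j = cong (approx x j ℚ.*_) (sym (inv-def d))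

m!*^≢0 : ∀ s m → NonZero (m ! ℕ.* suc m ℕ.^ s)
m!*^≢0 s m = ℕ.m*n≢0 (m !) (suc m ℕ.^ s) {{m ℕ.!≢0}} {{ℕ.m^n≢0 (suc m) s}}

m!*^*≢0 : ∀ s m → NonZero (m ! ℕ.* suc m ℕ.^ s ℕ.* (suc m ℕ.+ 1))
m!*^*≢0 s m = ℕ.m*n≢0 (m ! ℕ.* suc m ℕ.^ s) (suc m ℕ.+ 1) {{m!*^≢0 s m}} {{ℕ.>-nonZero (ℕ.m≤n+m 1 (suc m))}}

module _ (A : ℚ) (r m : ℕ) where

  private instance
    sm!≢0   = suc m ℕ.!≢0
    ^r≢0    = ℕ.m^n≢0 (suc m) r
    ^1+r≢0  = ℕ.m^n≢0 (suc m) (suc r)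
    m!*≢0   = m!*^≢0 (suc (suc r)) m
    m!**≢0  = m!*^*≢0 (suc r) m
    sm!*≢0  = ℕ.m*n≢0 (suc m !) (suc m ℕ.^ r)
    sm!*′≢0 = ℕ.m*n≢0 (suc m !) (suc m ℕ.^ suc r)
    sm!**≢0 = ℕ.m*n≢0 (suc m ! ℕ.* suc m ℕ.^ r) (2 ℕ.+ m)

  -- One factor n = m + 1 moves from the power into the factorial, because the recurrence is run for
  -- cₙ, the numerator over n!.
  !-*-^ : ∀ s → m ! ℕ.* suc m ℕ.^ suc s ≡ suc m ! ℕ.* suc m ℕ.^ s
  !-*-^ s = trans (sym (ℕ.*-assoc (m !) (suc m) (suc m ℕ.^ s)))
    (cong (ℕ._* suc m ℕ.^ s) (ℕ.*-comm (m !) (suc m)))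

  ζ-denominator : A ℚ.* inv ((suc m ∸ 1) ! ℕ.* suc m ℕ.^ (suc (suc r))) ≡ A ℚ.* inv (suc m !) ℚ.* inv (suc m ℕ.^ suc r)
  ζ-denominator = trans
    (cong (A ℚ.*_) (trans (inv-cong (!-*-^ (suc r))) (inv-* (suc m !) (suc m ℕ.^ suc r))))
    (sym (ℚ.*-assoc A (inv (suc m !)) (inv (suc m ℕ.^ suc r))))

  shifted-denominator : A ℚ.* inv ((suc m ∸ 1) ! ℕ.* suc m ℕ.^ suc r ℕ.* (suc m ℕ.+ 1))
    ≡ A ℚ.* inv (suc m !) ℚ.* inv (suc m ℕ.^ r) ℚ.* inv (2 ℕ.+ m)
  shifted-denominator = trans
    (cong (A ℚ.*_) (trans (inv-cong (cong₂ ℕ._*_ (!-*-^ r) (ℕ.+-comm (suc m) 1)))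
      (trans (inv-* (suc m ! ℕ.* suc m ℕ.^ r) (2 ℕ.+ m))
        (cong (ℚ._* inv (2 ℕ.+ m)) (inv-* (suc m !) (suc m ℕ.^ r))))))
    (ring A (inv (suc m !)) (inv (suc m ℕ.^ r)) (inv (2 ℕ.+ m)))
    where
    ring : ∀ A a b c → A ℚ.* (a ℚ.* b ℚ.* c) ≡ A ℚ.* a ℚ.* b ℚ.* c
    ring = solve 4 (λ A a b c → A :* (a :* b :* c) := A :* a :* b :* c) refl

-- Stated for a variable c: with - 1ℝ in its place, conversion checking would
-- evaluate the Cauchy proof of - 1ℝ.
product-suc : ∀ c l μ m j → approx c j ≡ ℚ.- 1ℚ → approx μ j ℚ.* approx l j ≡ 1ℚ →
  approx (c ^ suc m * l ^ suc m * degenerateFalling 1ℝ (2 ℕ.+ m) μ) j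
    ≡ approx (c ^ m * l ^ m * degenerateFalling 1ℝ (suc m) μ) j ℚ.* (nat (suc m) ℚ.- approx l j)
product-suc c l μ m j c≡-1 μl≡1 = begin
  (approx c j ℚ.* P) ℚ.* (q ℚ.* Q) ℚ.* (F ℚ.* (1ℚ ℚ.- n ℚ.* r))
    ≡⟨ cong (λ x → (x ℚ.* P) ℚ.* (q ℚ.* Q) ℚ.* (F ℚ.* (1ℚ ℚ.- n ℚ.* r))) c≡-1 ⟩
  (ℚ.- 1ℚ ℚ.* P) ℚ.* (q ℚ.* Q) ℚ.* (F ℚ.* (1ℚ ℚ.- n ℚ.* r))
    -- The new sign and power contribute -λ, and -λ (1 - n / λ) = n - λ once r q is replaced by 1.
    ≡⟨ ring P q Q F n r ⟩
  P ℚ.* Q ℚ.* F ℚ.* (n ℚ.* (r ℚ.* q) ℚ.- q)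
    ≡⟨ cong (λ x → P ℚ.* Q ℚ.* F ℚ.* (x ℚ.- q)) (trans (cong (n ℚ.*_) μl≡1) (ℚ.*-identityʳ n)) ⟩
  P ℚ.* Q ℚ.* F ℚ.* (n ℚ.- q) ∎
  where
  open ≡-Reasoning
  P = approx (c ^ m) j
  Q = approx (l ^ m) j
  F = approx (degenerateFalling 1ℝ (suc m) μ) j
  n = nat (suc m)
  q = approx l j
  r = approx μ j
  ring : ∀ P q Q F n r →
    (ℚ.- 1ℚ ℚ.* P) ℚ.* (q ℚ.* Q) ℚ.* (F ℚ.* (1ℚ ℚ.- n ℚ.* r)) ≡ P ℚ.* Q ℚ.* F ℚ.* (n ℚ.* (r ℚ.* q) ℚ.- q)
  ring = solve 6 (λ P q Q F n r →
    (:- con 1ℚ :* P) :* (q :* Q) :* (F :* (con 1ℚ :- n :* r)) := P :* Q :* F :* (n :* (r :* q) :- q)) refl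

-- The two series at late approximation indices.

module _ (l : ℝ) (l#0 : l # 0ℝ) where

  private
    t : ℕ → ℚ
    t j = approx (l + 1ℝ) j

    -- From here on the approximations of λ are bounded away from 0, so `recip` truly inverts them.
    J₀ : ℕ
    J₀ = let _ , _ , J , _ = bounded-away {l} l#0 in J

    recip-l : ∀ j → J₀ ≤ j → recip (approx l j) ℚ.* approx l j ≡ 1ℚ
    recip-l j J₀≤j =
      let _ , 0<δ , _ , δ≤∣l∣ = bounded-away {l} l#0
      in recip-inverse (ℚ.<-≤-trans 0<δ (δ≤∣l∣ j J₀≤j))

  numerator-suc : ∀ j → J₀ ≤ j → ∀ m →
    approx (numerator l l#0 (2 ℕ.+ m)) j
      ≡ approx (numerator l l#0 (suc m)) j ℚ.* (nat (suc m) ℚ.- approx l j)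
  numerator-suc j J₀≤j m =
    product-suc (- 1ℝ) l (l ⁻¹⟨ l#0 ⟩) m j refl (recip-l j J₀≤j)

  -- Passing from n = m + 1 to n + 1 multiplies the quotient by (n - λ) / (n + 1) = 1 - (λ + 1) / (n
  -- + 1), the factor in `coeff`.
  numerator-coeff : ∀ j → J₀ ≤ j → ∀ m →
    approx (numerator l l#0 (suc m)) j ℚ.* inv (suc m !) {{suc m ℕ.!≢0}} ≡ coeff (t j) m
  numerator-coeff j J₀≤j zero = trans (cong (approx (numerator l l#0 1) j ℚ.*_) (inv-def 1)) (ring (recip (approx l j)))
    where
    ring : ∀ r → 1ℚ ℚ.* 1ℚ ℚ.* (1ℚ ℚ.* (1ℚ ℚ.- 0ℚ ℚ.* r)) ℚ.* 1ℚ ≡ 1ℚ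
    ring = solve 1 (λ r → con 1ℚ :* con 1ℚ :* (con 1ℚ :* (con 1ℚ :- con 0ℚ :* r)) :* con 1ℚ := con 1ℚ) refl
  numerator-coeff j J₀≤j (suc m) = begin
    approx (numerator l l#0 (2 ℕ.+ m)) j ℚ.* inv ((2 ℕ.+ m) !)
      ≡⟨ cong₂ ℚ._*_ (numerator-suc j J₀≤j m) (inv-* (2 ℕ.+ m) (suc m !)) ⟩
    A ℚ.* (n ℚ.- q) ℚ.* (v ℚ.* w)
      ≡⟨ ring A n q v w ⟩
    (A ℚ.* w) ℚ.* ((n ℚ.+ 1ℚ) ℚ.* v ℚ.- (q ℚ.+ 1ℚ) ℚ.* v)
      ≡⟨ cong₂ (λ a b → a ℚ.* (b ℚ.- (q ℚ.+ 1ℚ) ℚ.* v)) (numerator-coeff j J₀≤j m)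
           (trans (cong (ℚ._* v) (sym (nat-suc (suc m)))) (nat-*-inv (2 ℕ.+ m))) ⟩
    coeff (t j) m ℚ.* (1ℚ ℚ.- t j ℚ.* v) ∎
    where
    open ≡-Reasoning
    instance
      _ = suc m ℕ.!≢0
      _ = (2 ℕ.+ m) ℕ.!≢0
    A = approx (numerator l l#0 (suc m)) j
    n = nat (suc m)
    q = approx l j
    v = inv (2 ℕ.+ m)
    w = inv (suc m !)
    ring : ∀ A n q v w →
      A ℚ.* (n ℚ.- q) ℚ.* (v ℚ.* w) ≡ (A ℚ.* w) ℚ.* ((n ℚ.+ 1ℚ) ℚ.* v ℚ.- (q ℚ.+ 1ℚ) ℚ.* v)
    ring = solve 5 (λ A n q v w →
      A :* (n :- q) :* (v :* w) := (A :* w) :* ((n :+ con 1ℚ) :* v :- (q :+ con 1ℚ) :* v)) refl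

  ζ-term-summand : ∀ r j → J₀ ≤ j → ∀ m →
    approx (ζ-term l l#0 (suc (suc r)) (suc m)) j ≡ ζ-summand (t j) r m
  ζ-term-summand r j J₀≤j m = trans
    (approx-/ℕ (numerator l l#0 (suc m)) ((suc m ∸ 1) ! ℕ.* suc m ℕ.^ (suc (suc r))) {{m!*^≢0 (suc (suc r)) m}} j)
    (trans (ζ-denominator (approx (numerator l l#0 (suc m)) j) r m)
      (cong (ℚ._* inv (suc m ℕ.^ suc r) {{ℕ.m^n≢0 (suc m) (suc r)}}) (numerator-coeff j J₀≤j m)))

  shifted-term-summand : ∀ r j → J₀ ≤ j → ∀ m →
    approx (shifted-term l l#0 (suc r) (suc m)) j ≡ shifted-summand (t j) r m
  shifted-term-summand r j J₀≤j m = trans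
    (approx-/ℕ (numerator l l#0 (suc m)) ((suc m ∸ 1) ! ℕ.* suc m ℕ.^ suc r ℕ.* (suc m ℕ.+ 1)) {{m!*^*≢0 (suc r) m}} j)
    (trans (shifted-denominator (approx (numerator l l#0 (suc m)) j) r m)
      (cong (λ x → x ℚ.* inv (suc m ℕ.^ r) {{ℕ.m^n≢0 (suc m) r}} ℚ.* inv (2 ℕ.+ m)) (numerator-coeff j J₀≤j m)))

  ζ-partial : ∀ s → 2 ≤ s → ∀ j → J₀ ≤ j → ∀ n →
    approx (∑ n (ζ-term l l#0 s)) j ≡ sum (ζ-summand (t j) (s ∸ 2)) n
  ζ-partial (suc (suc r)) (s≤s (s≤s z≤n)) j J₀≤j = approx-∑ {ζ-term l l#0 (suc (suc r))} (ζ-term-summand r j J₀≤j)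

  shifted-partial : ∀ r j → J₀ ≤ j → ∀ n →
    approx (∑ n (shifted-term l l#0 (suc r))) j ≡ sum (shifted-summand (t j) r) n
  shifted-partial r j J₀≤j = approx-∑ {shifted-term l l#0 (suc r)} (shifted-term-summand r j J₀≤j)

  -- Convergence for λ > -1 and divergence for λ < -1.

  positive-range : 0ℝ < l + 1ℝ → ∃[ δ ] ∃[ B ] ∃[ J ] 0ℚ ℚ.< δ × (∀ j → J ≤ j → δ ℚ.≤ t j × t j ℚ.≤ B)
  positive-range (δ , 0<δ , J , h) =
    let B , _ , K , bounded = eventually-bounded (l + 1ℝ)
    in δ , B , J ℕ.⊔ K , 0<δ , λ j ≤j →
      let δ≤t = ℚ.<⇒≤ (subst (ℚ._< t j) (ℚ.+-identityˡ δ) (h j (ℕ.m⊔n≤o⇒m≤o J K ≤j)))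
      in δ≤t , subst (ℚ._≤ B) (ℚ.0≤p⇒∣p∣≡p (ℚ.≤-trans (ℚ.<⇒≤ 0<δ) δ≤t)) (bounded j (ℕ.m⊔n≤o⇒n≤o J K ≤j))

  -- `ζ-partial-cauchy` is uniform in t, hence in the approximation index, as `uniform-limit`
  -- requires.
  ζ-summable : 0ℝ < l + 1ℝ → ∀ s → 2 ≤ s → Summable (ζ-term l l#0 s)
  ζ-summable 0<l+1 s 2≤s =
    let δ , B , J , 0<δ , range = positive-range 0<l+1
        L , lim = uniform-limit (λ n → ∑ n (ζ-term l l#0 s)) (J₀ ℕ.⊔ J) λ ε 0<ε →
          let M , h = ζ-partial-cauchy 0<δ (s ∸ 2) ε 0<ε
          in M , λ n j M≤n ≤j →
            let J₀≤j = ℕ.m⊔n≤o⇒m≤o J₀ J ≤j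
                δ≤t , t≤B = range j (ℕ.m⊔n≤o⇒n≤o J₀ J ≤j)
            in subst (λ e → ℚ.∣ e ∣ ℚ.< ε)
                 (cong₂ ℚ._-_
                   (trans (cong (sum (ζ-summand (t j) (s ∸ 2))) (ℕ.m∸n+n≡m M≤n)) (sym (ζ-partial s 2≤s j J₀≤j n)))
                   (sym (ζ-partial s 2≤s j J₀≤j M)))
                 (h (t j) δ≤t t≤B (n ∸ M))
    in L , ⟶ℚ⇒⟶ lim

  -- At late indices t is negative, and the harmonic sums then bound the partial sums from below
  -- independently of the index.
  ζ₂-diverges : l + 1ℝ < 0ℝ → ∀ z → ¬ ((λ n → ∑ n (ζ-term l l#0 2)) ⟶ℚ z)
  ζ₂-diverges (δ , 0<δ , J , h) z = unbounded⇒¬⟶ (λ n → ∑ n (ζ-term l l#0 2)) z (J ℕ.⊔ J₀) harmonic harmonic-unbounded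
    λ n j ≤j → subst (harmonic n ℚ.≤_) (sym (ζ-partial 2 ℕ.≤-refl j (ℕ.m⊔n≤o⇒n≤o J J₀ ≤j) n))
      (harmonic≤ζ-partial (ℚ.<⇒≤ (ℚ.<-trans (p<p+q (t j) 0<δ) (h j (ℕ.m⊔n≤o⇒m≤o J J₀ ≤j)))) n)

  -- Evaluation of the shifted series.

  module _ (l+1#0 : (l + 1ℝ) # 0ℝ) (ζ : ℕ → ℝ) (0<l+1 : 0ℝ < l + 1ℝ) where

    -- The induction starts at p = 1, where the sum of zeta values is empty and the series
    -- telescopes to 1 / (λ + 1).
    shifted₁-sum : (λ n → ∑ n (shifted-term l l#0 (suc zero))) ⟶ℚ
      (∑ (suc zero ∸ 1) (λ k → (- 1ℝ) ^ (k ∸ 1) * ζ (suc zero ∸ k ℕ.+ 1)) + (- 1ℝ) ^ (suc zero ∸ 1) * (l + 1ℝ) ⁻¹⟨ l+1#0 ⟩)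
    shifted₁-sum = limit λ ε 0<ε →
      let δ , B , J , 0<δ , range = positive-range 0<l+1
          -- The error is the coefficient divided by |t| ≥ δ, so ε δ is small enough.
          M , _ , small = coeff-vanishes 0<δ (ε ℚ.* δ) (*-pos 0<ε 0<δ)
      in M , λ n M≤n → J₀ ℕ.⊔ J , λ j ≤j →
        let J₀≤j = ℕ.m⊔n≤o⇒m≤o J₀ J ≤j
            δ≤t , t≤B = range j (ℕ.m⊔n≤o⇒n≤o J₀ J ≤j)
            ∣t∣≡t = ℚ.0≤p⇒∣p∣≡p (ℚ.≤-trans (ℚ.<⇒≤ 0<δ) δ≤t)
            δ≤∣t∣ = subst (δ ℚ.≤_) (sym ∣t∣≡t) δ≤t
            R = recip (t j)
        in subst (λ e → ℚ.∣ e ∣ ℚ.< ε)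
             (cong₂ ℚ._-_ (sym (shifted-partial zero j J₀≤j n))
               (solve 1 (λ R → R := con 0ℚ :+ con 1ℚ :* R) refl R))
             (shifted-partial-error (recip-inverse (ℚ.<-≤-trans 0<δ δ≤∣t∣)) n
               (ℚ.<-≤-trans (small (t j) δ≤t t≤B n M≤n)
                 (ℚ.*-monoˡ-≤-nonNeg ε {{ℚ.nonNegative (ℚ.<⇒≤ 0<ε)}} δ≤∣t∣)))

    shifted-partial-suc : ∀ r n j → J₀ ≤ j →
      approx (∑ n (shifted-term l l#0 (suc (suc r)))) j
        ≡ approx (∑ n (ζ-term l l#0 (suc (suc r)))) j ℚ.- approx (∑ n (shifted-term l l#0 (suc r))) j
    shifted-partial-suc r n j J₀≤j = begin
      approx (∑ n (shifted-term l l#0 (suc (suc r)))) j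
        ≡⟨ shifted-partial (suc r) j J₀≤j n ⟩
      sum (shifted-summand (t j) (suc r)) n
        ≡⟨ sum-cong (shifted-suc (t j) r) n ⟩
      sum (λ i → ζ-summand (t j) r i ℚ.- shifted-summand (t j) r i) n
        ≡⟨ sum-sub (ζ-summand (t j) r) (shifted-summand (t j) r) n ⟩
      sum (ζ-summand (t j) r) n ℚ.- sum (shifted-summand (t j) r) n
        ≡⟨ sym (cong₂ ℚ._-_ (ζ-partial (suc (suc r)) (s≤s (s≤s z≤n)) j J₀≤j n) (shifted-partial r j J₀≤j n)) ⟩
      approx (∑ n (ζ-term l l#0 (suc (suc r)))) j ℚ.- approx (∑ n (shifted-term l l#0 (suc r))) j ∎
      where open ≡-Reasoning

    -- The step to p = r + 2 takes ζ at r + 2 from the hypothesis and passes the smaller exponents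
    -- on to the induction.
    shifted-sum⁺ : ∀ r → (∀ s → 2 ≤ s → s ≤ suc r → (λ n → ∑ n (ζ-term l l#0 s)) ⟶ℚ ζ s) →
      (λ n → ∑ n (shifted-term l l#0 (suc r))) ⟶ℚ
        (∑ (suc r ∸ 1) (λ k → (- 1ℝ) ^ (k ∸ 1) * ζ (suc r ∸ k ℕ.+ 1)) + (- 1ℝ) ^ (suc r ∸ 1) * (l + 1ℝ) ⁻¹⟨ l+1#0 ⟩)
    shifted-sum⁺ zero    _      = shifted₁-sum
    shifted-sum⁺ (suc r) ζ-sums = ⟶-difference
      (ζ-sums (suc (suc r)) (s≤s (s≤s z≤n)) ℕ.≤-refl)
      (shifted-sum⁺ r λ s 2≤s s≤ → ζ-sums s 2≤s (ℕ.m≤n⇒m≤1+n s≤))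
      J₀ (shifted-partial-suc r)
      (λ j → alternating-suc (- 1ℝ) ((l + 1ℝ) ⁻¹⟨ l+1#0 ⟩) ζ r j refl)

  shifted-sum : (l+1#0 : (l + 1ℝ) # 0ℝ) (ζ : ℕ → ℝ) → ∀ p → 2 ≤ p →
    (∀ s → 2 ≤ s → s ≤ p → (λ n → ∑ n (ζ-term l l#0 s)) ⟶ℚ ζ s) →
    (λ n → ∑ n (shifted-term l l#0 p)) ⟶ℚ
      (∑ (p ∸ 1) (λ k → (- 1ℝ) ^ (k ∸ 1) * ζ (p ∸ k ℕ.+ 1)) + (- 1ℝ) ^ (p ∸ 1) * (l + 1ℝ) ⁻¹⟨ l+1#0 ⟩)
  -- For λ + 1 < 0 the sum assumed at exponent 2, available since p ≥ 2, cannot exist.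
  shifted-sum (inj₁ l+1<0) ζ p       2≤p ζ-sums = contradiction (ζ-sums 2 ℕ.≤-refl 2≤p) (ζ₂-diverges l+1<0 (ζ 2))
  shifted-sum (inj₂ 0<l+1) ζ (suc p) _   ζ-sums = shifted-sum⁺ (inj₂ 0<l+1) ζ 0<l+1 p ζ-sums

-1<l⇒0<l+1 : ∀ l → - 1ℝ < l → 0ℝ < l + 1ℝ
-1<l⇒0<l+1 l (δ , 0<δ , J , h) = δ , 0<δ , J , λ j J≤j →
  subst (ℚ._< approx l j ℚ.+ 1ℚ)
    (solve 1 (λ δ → (:- con 1ℚ :+ δ) :+ con 1ℚ := con 0ℚ :+ δ) refl δ)
    (ℚ.+-monoˡ-< 1ℚ (h j J≤j))

theorem3 : (l : ℝ) (l#0 : l # 0ℝ) (l+1#0 : (l + 1ℝ) # 0ℝ) (p : ℕ) → 2 ≤ p →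
    (- 1ℝ < l → ∀ s → 2 ≤ s → Summable (ζ-term l l#0 s)) ×
    ((ζ : ℕ → ℝ) →
    (∀ s → 2 ≤ s → s ≤ p → HasSum (ζ-term l l#0 s) (ζ s)) →
    HasSum (shifted-term l l#0 p)
    (∑ (p ∸ 1) (λ k → (- 1ℝ) ^ (k ∸ 1) * ζ (p ∸ k ℕ.+ 1))
    + (- 1ℝ) ^ (p ∸ 1) * (l + 1ℝ) ⁻¹⟨ l+1#0 ⟩))
theorem3 l l#0 l+1#0 p 2≤p =
  (λ -1<l → ζ-summable l l#0 (-1<l⇒0<l+1 l -1<l)) ,
  λ ζ ζ-sums → ⟶ℚ⇒⟶ (shifted-sum l l#0 l+1#0 ζ p 2≤p λ s 2≤s s≤p → ⟶⇒⟶ℚ (ζ-sums s 2≤s s≤p))
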